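{- Let $f:\{0,1\}^n\to\{0,1\}$ have alternation number $\operatorname{alt}(f)=k$. Then \[ bs(f)\le O\!\left(k\max\{\mathsf{N}(f)^2,\mathsf{N}(\overline f)^2\}\right). \]
   Context: $bs(f)$ is block sensitivity: the maximum over $x$ of the maximum number of pairwise disjoint sets $B\subseteq[n]$ with $f(x^B)\ne f(x)$, where $x^B$ is $x$ with the bits in $B$ flipped. $\mathsf{N}(f)$ is the minimum degree of a real polynomial $p$ with $|p(x)|\le 1/3$ whenever $f(x)=0$ and $|p(x)|\ge 1$ whenever $f(x)=1$; $\overline f=1-f$. A monotone path is a sequence $x^{(1)},\dots,x^{(m)}\in\{0,1\}^n$ where each $x^{(i+1)}$ is obtained from $x^{(i)}$ by changing exactly one coordinate from $0$ to $1$; its alternation number is the number of $i$ with $f(x^{(i)})\ne f(x^{(i+1)})$; $\operatorname{alt}(f)$ is the maximum alternation number over monotone paths from $0^n$ to $1^n$. The $O(\cdot)$ hides an absolute constant.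
   Formalization: In the formal statement the polynomials that define N(f) and N(f̄) have rational rather than real coefficients; the minimum degree is the same, because a linear system with rational data that is solvable over the reals is solvable over the rationals. -}

module Defs where

import Data.Nat as ℕ
open ℕ using (ℕ; zero; suc; _⊔_)
open import Data.Fin using (Fin; zero; suc)
open import Data.Bool using (Bool; true; false; if_then_else_; _xor_; _∧_)
open import Data.List using (List; []; _∷_)
open import Data.Product using (Σ; _×_; _,_)
open import Data.Empty using (⊥)
open import Relation.Binary.PropositionalEquality using (_≡_; _≢_)
open import Relation.Nullary using (¬_)
open import Data.Integer using (+_)
open import Data.Rational as ℚ using (ℚ; 0ℚ; 1ℚ; ∣_∣; _/_)

Input : ℕ → Set
Input n = Fin n → Bool

BoolFun : ℕ → Set
BoolFun n = Input n → Bool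

compl : ∀ {n} → BoolFun n → BoolFun n
compl f x = if f x then false else true

-- x^B : flip the bits of x in the set B (subsets of [n] are indicator functions).
flipB : ∀ {n} → Input n → Input n → Input n
flipB x B i = x i xor B i

HasBlocks : ∀ {n} → BoolFun n → Input n → ℕ → Set
HasBlocks {n} f x m =
  Σ (Fin m → Input n) λ B →
    (∀ (i j : Fin m) → i ≢ j → ∀ (t : Fin n) → B i t ∧ B j t ≡ false)
    × (∀ (i : Fin m) → f (flipB x (B i)) ≢ f x)

IsBS : ∀ {n} → BoolFun n → ℕ → Set
IsBS {n} f b =
  Σ (Input n) (λ x → HasBlocks f x b)
  × (∀ (x : Input n) (m : ℕ) → HasBlocks f x m → m ℕ.≤ b)

allFalse : ∀ {n} → Input n
allFalse _ = false

allTrue : ∀ {n} → Input n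
allTrue _ = true

Step : ∀ {n} → Input n → Input n → Set
Step {n} x y = Σ (Fin n) λ i → (x i ≡ false) × (y i ≡ true) × (∀ j → j ≢ i → y j ≡ x j)

data MonoPath {n : ℕ} : Input n → Input n → List (Input n) → Set where
  done : ∀ {x} → MonoPath x x []
  step : ∀ {x y z ys} → Step x y → MonoPath y z ys → MonoPath x z (y ∷ ys)

alts : ∀ {n} → BoolFun n → Input n → List (Input n) → ℕ
alts f x [] = 0
alts f x (y ∷ ys) = (if f x xor f y then 1 else 0) ℕ.+ alts f y ys

IsAlt : ∀ {n} → BoolFun n → ℕ → Set
IsAlt {n} f k =
  Σ (List (Input n)) (λ ys → MonoPath allFalse allTrue ys × alts f allFalse ys ≡ k)
  × (∀ ys → MonoPath allFalse allTrue ys → alts f allFalse ys ℕ.≤ k)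

-- A polynomial: coefficient c S of the monomial Π_{i ∈ S} x_i, for each S ⊆ [n].
Poly : ℕ → Set
Poly n = Input n → ℚ

weight : ∀ {n} → Input n → ℕ
weight {zero} S = 0
weight {suc n} S = (if S zero then 1 else 0) ℕ.+ weight (λ i → S (suc i))

sumCube : (n : ℕ) → (Input n → ℚ) → ℚ
sumCube zero g = g (λ ())
sumCube (suc n) g =
  sumCube n (λ x → g (λ { zero → false ; (suc i) → x i }))
  ℚ.+ sumCube n (λ x → g (λ { zero → true ; (suc i) → x i }))

monomial : ∀ {n} → Input n → Input n → ℚ
monomial {zero} S x = 1ℚ
monomial {suc n} S x =
  (if S zero then (if x zero then 1ℚ else 0ℚ) else 1ℚ)
  ℚ.* monomial (λ i → S (suc i)) (λ i → x (suc i))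

eval : ∀ {n} → Poly n → Input n → ℚ
eval {n} c x = sumCube n (λ S → c S ℚ.* monomial S x)

DegLe : ∀ {n} → Poly n → ℕ → Set
DegLe c d = ∀ S → c S ≢ 0ℚ → weight S ℕ.≤ d

NDRep : ∀ {n} → BoolFun n → Poly n → Set
NDRep f c = ∀ x → (f x ≡ false → ∣ eval c x ∣ ℚ.≤ (+ 1) / 3)
                × (f x ≡ true → 1ℚ ℚ.≤ ∣ eval c x ∣)

IsN : ∀ {n} → BoolFun n → ℕ → Set
IsN {n} f d =
  Σ (Poly n) (λ c → DegLe c d × NDRep f c)
  × (∀ (c : Poly n) (d' : ℕ) → DegLe c d' → NDRep f c → d ℕ.≤ d')

{-# OPTIONS --safe #-}
module Submission where

-- Let D = max {N(f)², N(f̄)²}.  If f is constant on a subcube except at one corner, the subcube has dimension at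
-- most c = O(D): a polynomial that is ≤ 1/3 in absolute value off the corner and ≥ 1 at it becomes, after flipping
-- each coordinate of the corner independently with probability θ, a univariate polynomial F(θ) with |F| ≤ |F(0)|/2
-- at the quadratically spaced points θᵢ = (100 (i - N)² + 5) / dim, N = deg F.  The 2N-th finite difference of
-- (F(θ) - F(0)) / θ along these points vanishes, and its central term is too large to be cancelled by the others.
--
-- Hence alternating chains can be chosen greedily with steps of length at most c.  For x with disjoint sensitive
-- blocks Bᵢ, shrink the cube to an interval around x in which f is constant below and above x; this costs at most
-- c blocks per alternation used.  Then move x to x ∪ Bₗ or x ∖ Bₗ, where f is unchanged.  This keeps every block Bᵢ
-- such that setting Bₗ does not change f at x^Bᵢ; double counting the pairs (i, l) gives an l and a direction in which
-- the number of blocks lost is at most the number of blocks that are one-sidedly sensitive at x^Bₗ in the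
-- opposite direction.  The latter number is at most c times the number of alternations between x^Bₗ and the end of
-- the interval, so again O(c) blocks are lost for each alternation that becomes unavailable, k in total.

open import Defs
open import Data.Nat using (ℕ; _≤_; _*_; _⊔_)
open import Data.Product using (Σ)
open import Algebra.Properties.CommutativeSemigroup using (interchange)
open import Data.Bool using (Bool; true; false; if_then_else_; _xor_; _∧_; not)
import Data.Bool.Properties as Bool
open import Data.Empty using (⊥-elim)
open import Data.Fin using (Fin; zero; suc)
import Data.Fin.Properties as Fin
import Data.Integer as ℤ
open import Data.List using (List; []; _∷_; _++_; length; map; filter; tabulate)
open import Data.List.Membership.Propositional using (_∈_)
open import Data.List.Membership.Propositional.Properties using (∈-filter⁻; ∈-tabulate⁻)
open import Data.List.Properties using (length-tabulate)
import Data.List.Relation.Unary.All as All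
open import Data.List.Relation.Unary.AllPairs using (AllPairs; []; _∷_)
import Data.List.Relation.Unary.AllPairs.Properties as AllPairs
open import Data.List.Relation.Unary.Any using (here; there)
open import Data.Nat using (zero; suc; pred; _<_; _+_; _∸_; ∣_-_∣; z≤n; s≤s; s≤s⁻¹; >-nonZero)
open import Data.Nat.Combinatorics using (_C_; nCk≡nC[n∸k]; nCn≡1; nCk+nC[k+1]≡[n+1]C[k+1]; k>n⇒nCk≡0)
open import Data.Nat.ListAction using (sum)
import Data.Nat.Properties as ℕ
open import Data.Nat.Tactic.RingSolver using (solve-∀)
open import Data.Product using (_×_; _,_; proj₁; proj₂)
open import Data.Rational as ℚ using (ℚ; 0ℚ; 1ℚ; ½)
import Data.Rational.Properties as ℚ
open import Data.Rational.Solver using (module +-*-Solver)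
open import Data.Sum using (_⊎_; inj₁; inj₂)
open import Data.Unit using (tt)
open import Data.Vec.Functional using () renaming (_∷_ to _◂_)
open import Function using (_∘_)
open import Relation.Binary.PropositionalEquality
open import Relation.Nullary using (¬_; Dec; yes; no; does)
open import Relation.Nullary.Decidable using (_×-dec_; _→-dec_; ¬?; map′; toWitness)

open +-*-Solver using (solve; _:+_; _:*_; _:-_; :-_; _:=_; con)

-- Rational inequalities and the embedding of ℕ into ℚ.

*-monoˡ : ∀ {r p q} → 0ℚ ℚ.≤ r → p ℚ.≤ q → r ℚ.* p ℚ.≤ r ℚ.* q
*-monoˡ {r} 0≤r = ℚ.*-monoˡ-≤-nonNeg r {{ℚ.nonNegative 0≤r}}

*-monoʳ : ∀ {r p q} → 0ℚ ℚ.≤ r → p ℚ.≤ q → p ℚ.* r ℚ.≤ q ℚ.* r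
*-monoʳ {r} 0≤r = ℚ.*-monoʳ-≤-nonNeg r {{ℚ.nonNegative 0≤r}}

0≤+ : ∀ {p q} → 0ℚ ℚ.≤ p → 0ℚ ℚ.≤ q → 0ℚ ℚ.≤ p ℚ.+ q
0≤+ 0≤p 0≤q = ℚ.+-mono-≤ 0≤p 0≤q

0≤* : ∀ {p q} → 0ℚ ℚ.≤ p → 0ℚ ℚ.≤ q → 0ℚ ℚ.≤ p ℚ.* q
0≤* {p} {q} 0≤p 0≤q = subst (ℚ._≤ p ℚ.* q) (ℚ.*-zeroʳ p) (*-monoˡ 0≤p 0≤q)

p≤q⇒0≤q-p : ∀ {p q} → p ℚ.≤ q → 0ℚ ℚ.≤ q ℚ.- p
p≤q⇒0≤q-p {p} {q} p≤q = subst (ℚ._≤ q ℚ.- p) (ℚ.+-inverseʳ p) (ℚ.+-monoˡ-≤ (ℚ.- p) p≤q)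

0≤q-p⇒p≤q : ∀ {p q} → 0ℚ ℚ.≤ q ℚ.- p → p ℚ.≤ q
0≤q-p⇒p≤q {p} {q} 0≤d = subst₂ ℚ._≤_ (ℚ.+-identityˡ p)
  (solve 2 (λ p q → (q :- p) :+ p := q) refl p q) (ℚ.+-monoˡ-≤ p 0≤d)

0≤1 : 0ℚ ℚ.≤ 1ℚ
0≤1 = ℚ.nonNegative⁻¹ 1ℚ

ι : ℕ → ℚ
ι zero    = 0ℚ
ι (suc n) = 1ℚ ℚ.+ ι n

ι-nonNeg : ∀ n → 0ℚ ℚ.≤ ι n
ι-nonNeg zero    = ℚ.≤-refl
ι-nonNeg (suc n) = 0≤+ 0≤1 (ι-nonNeg n)

ι-+ : ∀ m n → ι (m + n) ≡ ι m ℚ.+ ι n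
ι-+ zero    n = sym (ℚ.+-identityˡ (ι n))
ι-+ (suc m) n = trans (cong (1ℚ ℚ.+_) (ι-+ m n)) (sym (ℚ.+-assoc 1ℚ (ι m) (ι n)))

ι-* : ∀ m n → ι (m * n) ≡ ι m ℚ.* ι n
ι-* zero    n = sym (ℚ.*-zeroˡ (ι n))
ι-* (suc m) n = begin
  ι (n + m * n)             ≡⟨ ι-+ n (m * n) ⟩
  ι n ℚ.+ ι (m * n)         ≡⟨ cong (ι n ℚ.+_) (ι-* m n) ⟩
  ι n ℚ.+ ι m ℚ.* ι n       ≡⟨ solve 2 (λ m n → n :+ m :* n := (con 1ℚ :+ m) :* n) refl (ι m) (ι n) ⟩
  (1ℚ ℚ.+ ι m) ℚ.* ι n      ∎
  where open ≡-Reasoning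

ι-mono : ∀ {m n} → m ≤ n → ι m ℚ.≤ ι n
ι-mono {n = n} z≤n = ι-nonNeg n
ι-mono (s≤s p) = ℚ.+-monoʳ-≤ 1ℚ (ι-mono p)

ι-pos : ∀ n → 0ℚ ℚ.< ι (suc n)
ι-pos n = ℚ.<-≤-trans (ℚ.positive⁻¹ 1ℚ) (subst (ℚ._≤ ι (suc n)) (ℚ.+-identityʳ 1ℚ) (ℚ.+-monoʳ-≤ 1ℚ (ι-nonNeg n)))

ι-nonZero : ∀ n → ℚ.NonZero (ι (suc n))
ι-nonZero n = ℚ.pos⇒nonZero (ι (suc n)) {{ℚ.positive (ι-pos n)}}

-- The index is shifted: `recip n` is 1 / (n + 1), so no nonzero hypothesis has to be carried along.
recip : ℕ → ℚ
recip n = (ℚ.1/ ι (suc n)) {{ι-nonZero n}}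

ι*recip : ∀ n → ι (suc n) ℚ.* recip n ≡ 1ℚ
ι*recip n = ℚ.*-inverseʳ (ι (suc n)) {{ι-nonZero n}}

recip-nonNeg : ∀ n → 0ℚ ℚ.≤ recip n
recip-nonNeg n = ℚ.<⇒≤ (ℚ.positive⁻¹ (recip n) {{ℚ.1/pos⇒pos (ι (suc n)) {{ℚ.positive (ι-pos n)}}}})

-- Finite sums.

sumTo : ℕ → (ℕ → ℚ) → ℚ
sumTo zero    a = 0ℚ
sumTo (suc n) a = a 0 ℚ.+ sumTo n (a ∘ suc)

sumTo-cong : ∀ n {a b : ℕ → ℚ} → (∀ i → a i ≡ b i) → sumTo n a ≡ sumTo n b
sumTo-cong zero    eq = refl
sumTo-cong (suc n) eq = cong₂ ℚ._+_ (eq 0) (sumTo-cong n (eq ∘ suc))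

sumTo-+ : ∀ n (a b : ℕ → ℚ) → sumTo n (λ i → a i ℚ.+ b i) ≡ sumTo n a ℚ.+ sumTo n b
sumTo-+ zero    a b = sym (ℚ.+-identityˡ 0ℚ)
sumTo-+ (suc n) a b = trans (cong ((a 0 ℚ.+ b 0) ℚ.+_) (sumTo-+ n (a ∘ suc) (b ∘ suc)))
  (solve 4 (λ w x y z → (w :+ x) :+ (y :+ z) := (w :+ y) :+ (x :+ z)) refl (a 0) (b 0) (sumTo n (a ∘ suc)) (sumTo n (b ∘ suc)))

sumTo-* : ∀ n c (a : ℕ → ℚ) → sumTo n (λ i → c ℚ.* a i) ≡ c ℚ.* sumTo n a
sumTo-* zero    c a = sym (ℚ.*-zeroʳ c)
sumTo-* (suc n) c a = trans (cong (c ℚ.* a 0 ℚ.+_) (sumTo-* n c (a ∘ suc))) (sym (ℚ.*-distribˡ-+ c (a 0) _))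

sumTo-last : ∀ n (a : ℕ → ℚ) → sumTo (suc n) a ≡ sumTo n a ℚ.+ a n
sumTo-last zero    a = ℚ.+-comm (a 0) 0ℚ
sumTo-last (suc n) a = trans (cong (a 0 ℚ.+_) (sumTo-last n (a ∘ suc))) (sym (ℚ.+-assoc (a 0) _ _))

∣sumTo∣≤ : ∀ n {a w : ℕ → ℚ} → (∀ i → ℚ.∣ a i ∣ ℚ.≤ w i) → ℚ.∣ sumTo n a ∣ ℚ.≤ sumTo n w
∣sumTo∣≤ zero    le = ℚ.≤-refl
∣sumTo∣≤ (suc n) {a} le = ℚ.≤-trans (ℚ.∣p+q∣≤∣p∣+∣q∣ (a 0) _) (ℚ.+-mono-≤ (le 0) (∣sumTo∣≤ n (le ∘ suc)))

-- Term `N` cancels in the difference, so the other terms are bounded by the triangle inequality,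
-- and at `N` a nonnegative `w` suffices. If the whole sum vanishes, this bounds one term by the
-- others.
∣term-sumTo∣≤ : ∀ K N (a w : ℕ → ℚ) → N < K → 0ℚ ℚ.≤ w N → (∀ i → i ≢ N → ℚ.∣ a i ∣ ℚ.≤ w i) →
                ℚ.∣ a N ℚ.- sumTo K a ∣ ℚ.≤ sumTo K w
∣term-sumTo∣≤ (suc K) zero a w N<K 0≤w le = begin
  ℚ.∣ a 0 ℚ.- (a 0 ℚ.+ S) ∣ ≡⟨ cong ℚ.∣_∣ (solve 2 (λ x s → x :- (x :+ s) := :- s) refl (a 0) S) ⟩
  ℚ.∣ ℚ.- S ∣               ≡⟨ ℚ.∣-p∣≡∣p∣ S ⟩
  ℚ.∣ S ∣                   ≤⟨ ∣sumTo∣≤ K (λ i → le (suc i) (λ ())) ⟩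
  sumTo K (w ∘ suc)         ≡⟨ ℚ.+-identityˡ _ ⟨
  0ℚ ℚ.+ sumTo K (w ∘ suc)  ≤⟨ ℚ.+-monoˡ-≤ _ 0≤w ⟩
  sumTo (suc K) w           ∎
  where
  open ℚ.≤-Reasoning
  S = sumTo K (a ∘ suc)
∣term-sumTo∣≤ (suc K) (suc N) a w (s≤s N<K) 0≤w le = begin
  ℚ.∣ a (suc N) ℚ.- (a 0 ℚ.+ S) ∣         ≡⟨ cong ℚ.∣_∣ (solve 3 (λ y x s → y :- (x :+ s) := (:- x) :+ (y :- s)) refl (a (suc N)) (a 0) S) ⟩
  ℚ.∣ ℚ.- a 0 ℚ.+ (a (suc N) ℚ.- S) ∣     ≤⟨ ℚ.∣p+q∣≤∣p∣+∣q∣ (ℚ.- a 0) _ ⟩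
  ℚ.∣ ℚ.- a 0 ∣ ℚ.+ ℚ.∣ a (suc N) ℚ.- S ∣ ≡⟨ cong (ℚ._+ ℚ.∣ a (suc N) ℚ.- S ∣) (ℚ.∣-p∣≡∣p∣ (a 0)) ⟩
  ℚ.∣ a 0 ∣ ℚ.+ ℚ.∣ a (suc N) ℚ.- S ∣     ≤⟨ ℚ.+-mono-≤ (le 0 (λ ())) (∣term-sumTo∣≤ K N (a ∘ suc) (w ∘ suc) N<K 0≤w (λ i i≢N → le (suc i) (i≢N ∘ ℕ.suc-injective))) ⟩
  sumTo (suc K) w                         ∎
  where
  open ℚ.≤-Reasoning
  S = sumTo K (a ∘ suc)

-- Binomial coefficients and finite differences

nC0≡1 : ∀ n → n C 0 ≡ 1
nC0≡1 n = trans (nCk≡nC[n∸k] {0} {n} z≤n) (nCn≡1 n)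

-- Pascal's rule applied to row n + 1 at k + 1 and k + 2 leaves the comparison of `n C k` with
-- `n C suc (suc k)`: two rises in row n, or, when n = 2k + 2, an equality by symmetry.
C-rises : ∀ n k → suc (k + k) ≤ n → n C k ≤ n C suc k
C-rises (suc n) zero    (s≤s p) = subst (_≤ suc n C 1) (trans (nC0≡1 n) (sym (nC0≡1 (suc n))))
  (ℕ.≤-trans (ℕ.m≤m+n (n C 0) (n C 1)) (ℕ.≤-reflexive (nCk+nC[k+1]≡[n+1]C[k+1] n 0)))
C-rises (suc n) (suc k) (s≤s p) = begin
  suc n C suc k                ≡⟨ nCk+nC[k+1]≡[n+1]C[k+1] n k ⟨
  n C k + n C suc k            ≡⟨ ℕ.+-comm (n C k) _ ⟩
  n C suc k + n C k            ≤⟨ ℕ.+-monoʳ-≤ (n C suc k) skip ⟩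
  n C suc k + n C suc (suc k)  ≡⟨ nCk+nC[k+1]≡[n+1]C[k+1] n (suc k) ⟩
  suc n C suc (suc k)          ∎
  where
  open ℕ.≤-Reasoning
  2k+2≤n : suc (suc (k + k)) ≤ n
  2k+2≤n = subst (_≤ n) (cong suc (ℕ.+-suc k k)) p
  skip : n C k ≤ n C suc (suc k)
  skip with ℕ.m≤n⇒m<n∨m≡n 2k+2≤n
  ... | inj₁ 2k+3≤n = ℕ.≤-trans (C-rises n k (ℕ.<⇒≤ 2k+2≤n))
                        (C-rises n (suc k) (subst (_≤ n) (cong (2 +_) (sym (ℕ.+-suc k k))) 2k+3≤n))
  ... | inj₂ refl = ℕ.≤-reflexive (sym (trans (nCk≡nC[n∸k] {suc (suc k)} {suc (suc (k + k))} (s≤s (s≤s (ℕ.m≤m+n k k))))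
                      (cong (suc (suc (k + k)) C_) (ℕ.m+n∸n≡m k k))))

C-rises-to : ∀ N d k → k + d ≡ N → (N + N) C k ≤ (N + N) C N
C-rises-to N zero    k eq = ℕ.≤-reflexive (cong ((N + N) C_) (trans (sym (ℕ.+-identityʳ k)) eq))
C-rises-to N (suc d) k eq = ℕ.≤-trans (C-rises (N + N) k 2k<2N) (C-rises-to N d (suc k) (trans (sym (ℕ.+-suc k d)) eq))
  where
  k<N : k < N
  k<N = subst (suc k ≤_) eq (subst (suc k ≤_) (sym (ℕ.+-suc k d)) (s≤s (ℕ.m≤m+n k d)))
  2k<2N : suc (k + k) ≤ N + N
  2k<2N = ℕ.+-mono-≤ k<N (ℕ.<⇒≤ k<N)

C≤central : ∀ N k → (N + N) C k ≤ (N + N) C N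
C≤central N k with k ℕ.≤? N
... | yes k≤N = C-rises-to N (N ∸ k) k (ℕ.m+[n∸m]≡n k≤N)
... | no k≰N with k ℕ.≤? N + N
...   | yes k≤2N = subst (_≤ _) (sym (nCk≡nC[n∸k] k≤2N)) (C-rises-to N (N ∸ (N + N ∸ k)) (N + N ∸ k) (ℕ.m+[n∸m]≡n 2N-k≤N))
  where
  2N-k≤N : N + N ∸ k ≤ N
  2N-k≤N = subst (N + N ∸ k ≤_) (ℕ.m+n∸n≡m N N) (ℕ.∸-monoʳ-≤ (N + N) (ℕ.<⇒≤ (ℕ.≰⇒> k≰N)))
...   | no k≰2N = subst (_≤ _) (sym (k>n⇒nCk≡0 (ℕ.≰⇒> k≰2N))) z≤n

-- The binomial sum of `g`, computed by applying n times the operator that adds to a sequence its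
-- shift. With alternating signs it becomes the n-th finite difference.
pascalSum : ℕ → (ℕ → ℚ) → ℚ
pascalSum zero    g = g 0
pascalSum (suc n) g = pascalSum n (λ i → g i ℚ.+ g (suc i))

pascalSum-cong : ∀ n {g h : ℕ → ℚ} → (∀ i → g i ≡ h i) → pascalSum n g ≡ pascalSum n h
pascalSum-cong zero    eq = eq 0
pascalSum-cong (suc n) eq = pascalSum-cong n (λ i → cong₂ ℚ._+_ (eq i) (eq (suc i)))

pascalSum-binomial : ∀ n g → pascalSum n g ≡ sumTo (suc n) (λ i → ι (n C i) ℚ.* g i)
pascalSum-binomial zero    g = solve 1 (λ x → x := (con 1ℚ :+ con 0ℚ) :* x :+ con 0ℚ) refl (g 0)
pascalSum-binomial (suc n) g = begin
  pascalSum n (λ i → g i ℚ.+ g (suc i))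
    ≡⟨ pascalSum-binomial n _ ⟩
  sumTo (suc n) (λ i → c i ℚ.* (g i ℚ.+ g (suc i)))
    ≡⟨ sumTo-cong (suc n) (λ i → ℚ.*-distribˡ-+ (c i) (g i) (g (suc i))) ⟩
  sumTo (suc n) (λ i → c i ℚ.* g i ℚ.+ c i ℚ.* g (suc i))
    ≡⟨ sumTo-+ (suc n) (λ i → c i ℚ.* g i) (λ i → c i ℚ.* g (suc i)) ⟩
  sumTo (suc n) (λ i → c i ℚ.* g i) ℚ.+ R
    ≡⟨ cong (ℚ._+ R) extend ⟩
  (c 0 ℚ.* g 0 ℚ.+ Q) ℚ.+ R
    ≡⟨ solve 3 (λ x y z → (x :+ y) :+ z := x :+ (z :+ y)) refl (c 0 ℚ.* g 0) Q R ⟩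
  c 0 ℚ.* g 0 ℚ.+ (R ℚ.+ Q)
    ≡⟨ cong₂ (λ x y → ι x ℚ.* g 0 ℚ.+ y) (trans (nC0≡1 n) (sym (nC0≡1 (suc n)))) (sym (sumTo-+ (suc n) (λ i → c i ℚ.* g (suc i)) (λ i → c (suc i) ℚ.* g (suc i)))) ⟩
  ι (suc n C 0) ℚ.* g 0 ℚ.+ sumTo (suc n) (λ i → c i ℚ.* g (suc i) ℚ.+ c (suc i) ℚ.* g (suc i))
    ≡⟨ cong (ι (suc n C 0) ℚ.* g 0 ℚ.+_) (sumTo-cong (suc n) merge) ⟩
  sumTo (suc (suc n)) (λ i → ι (suc n C i) ℚ.* g i) ∎
  where
  open ≡-Reasoning
  c : ℕ → ℚ
  c i = ι (n C i)
  Q R : ℚ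
  Q = sumTo (suc n) (λ i → c (suc i) ℚ.* g (suc i))
  R = sumTo (suc n) (λ i → c i ℚ.* g (suc i))
  -- The sum is lengthened by a term with coefficient `n C suc n`, which is 0, so that both sums
  -- align for Pascal's rule.
  extend : sumTo (suc n) (λ i → c i ℚ.* g i) ≡ sumTo (suc (suc n)) (λ i → c i ℚ.* g i)
  extend = sym (trans (sumTo-last (suc n) (λ i → c i ℚ.* g i)) (trans
    (cong (λ z → sumTo (suc n) (λ i → c i ℚ.* g i) ℚ.+ ι z ℚ.* g (suc n)) (k>n⇒nCk≡0 (ℕ.n<1+n n)))
    (solve 2 (λ s x → s :+ con 0ℚ :* x := s) refl (sumTo (suc n) (λ i → c i ℚ.* g i)) (g (suc n)))))
  merge : ∀ i → c i ℚ.* g (suc i) ℚ.+ c (suc i) ℚ.* g (suc i) ≡ ι (suc n C suc i) ℚ.* g (suc i)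
  merge i = trans (sym (ℚ.*-distribʳ-+ (g (suc i)) (c i) (c (suc i))))
    (cong (ℚ._* g (suc i)) (trans (sym (ι-+ (n C i) (n C suc i))) (cong ι (nCk+nC[k+1]≡[n+1]C[k+1] n i))))

-- Polynomial degree of a sequence without coefficients: the r-th difference vanishes. The
-- orientation `h i ℚ.- h (suc i)` is the one produced by the alternating signs in `pascalSum`.
SeqDeg< : ℕ → (ℕ → ℚ) → Set
SeqDeg< zero    h = ∀ i → h i ≡ 0ℚ
SeqDeg< (suc r) h = SeqDeg< r (λ i → h i ℚ.- h (suc i))

SeqDeg<-cong : ∀ r {g h} → (∀ i → g i ≡ h i) → SeqDeg< r g → SeqDeg< r h
SeqDeg<-cong zero    eq d = λ i → trans (sym (eq i)) (d i)
SeqDeg<-cong (suc r) eq d = SeqDeg<-cong r (λ i → cong₂ ℚ._-_ (eq i) (eq (suc i))) d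

SeqDeg<-zero : ∀ r {h} → (∀ i → h i ≡ 0ℚ) → SeqDeg< r h
SeqDeg<-zero zero    eq = eq
SeqDeg<-zero (suc r) eq = SeqDeg<-zero r (λ i → cong₂ ℚ._-_ (eq i) (eq (suc i)))

SeqDeg<-suc : ∀ r {h} → SeqDeg< r h → SeqDeg< (suc r) h
SeqDeg<-suc zero    d = λ i → cong₂ ℚ._-_ (d i) (d (suc i))
SeqDeg<-suc (suc r) d = SeqDeg<-suc r d

SeqDeg<-const : ∀ r c → SeqDeg< (suc r) (λ _ → c)
SeqDeg<-const r c = SeqDeg<-zero r (λ _ → ℚ.+-inverseʳ c)

SeqDeg<-+ : ∀ r {g h} → SeqDeg< r g → SeqDeg< r h → SeqDeg< r (λ i → g i ℚ.+ h i)
SeqDeg<-+ zero    dg dh i = cong₂ ℚ._+_ (dg i) (dh i)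
SeqDeg<-+ (suc r) {g} {h} dg dh = SeqDeg<-cong r
  (λ i → solve 4 (λ a b c d → (a :- b) :+ (c :- d) := (a :+ c) :- (b :+ d)) refl (g i) (g (suc i)) (h i) (h (suc i)))
  (SeqDeg<-+ r dg dh)

SeqDeg<-* : ∀ r c {h} → SeqDeg< r h → SeqDeg< r (λ i → c ℚ.* h i)
SeqDeg<-* zero    c dh i = trans (cong (c ℚ.*_) (dh i)) (ℚ.*-zeroʳ c)
SeqDeg<-* (suc r) c {h} dh = SeqDeg<-cong r
  (λ i → solve 3 (λ c a b → c :* (a :- b) := c :* a :- c :* b) refl c (h i) (h (suc i)))
  (SeqDeg<-* r c dh)

SeqDeg<-shift : ∀ r {h} → SeqDeg< r h → SeqDeg< r (h ∘ suc)
SeqDeg<-shift zero    d = d ∘ suc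
SeqDeg<-shift (suc r) d = SeqDeg<-shift r d

-- Product rule: the difference of (i - c) h(i) is (i - c) times the difference of h, minus h(i +
-- 1).
SeqDeg<-linear : ∀ r c {h} → SeqDeg< r h → SeqDeg< (suc r) (λ i → (ι i ℚ.- c) ℚ.* h i)
SeqDeg<-linear zero    c dh = SeqDeg<-zero 1 (λ i → trans (cong ((ι i ℚ.- c) ℚ.*_) (dh i)) (ℚ.*-zeroʳ (ι i ℚ.- c)))
SeqDeg<-linear (suc r) c {h} dh = SeqDeg<-cong (suc r)
  (λ i → solve 4 (λ n c a b → (n :- c) :* (a :- b) :+ con (ℚ.- 1ℚ) :* b := (n :- c) :* a :- ((con 1ℚ :+ n) :- c) :* b)
           refl (ι i) c (h i) (h (suc i)))
  (SeqDeg<-+ (suc r) {λ i → (ι i ℚ.- c) ℚ.* (h i ℚ.- h (suc i))} {λ i → ℚ.- 1ℚ ℚ.* h (suc i)}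
    (SeqDeg<-linear r c dh) (SeqDeg<-* (suc r) (ℚ.- 1ℚ) {h ∘ suc} (SeqDeg<-shift (suc r) {h} dh)))

sign : ℕ → ℚ
sign zero    = 1ℚ
sign (suc n) = ℚ.- sign n

∣sign*∣ : ∀ n p → ℚ.∣ sign n ℚ.* p ∣ ≡ ℚ.∣ p ∣
∣sign*∣ zero    p = cong ℚ.∣_∣ (ℚ.*-identityˡ p)
∣sign*∣ (suc n) p = trans (cong ℚ.∣_∣ (sym (ℚ.neg-distribˡ-* (sign n) p))) (trans (ℚ.∣-p∣≡∣p∣ _) (∣sign*∣ n p))

-- The sign change turns each sum of neighbours into a difference, so n rounds produce the n-th
-- difference.
pascalSum-alternating : ∀ n {h} → SeqDeg< n h → pascalSum n (λ i → sign i ℚ.* h i) ≡ 0ℚ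
pascalSum-alternating zero    {h} d = trans (ℚ.*-identityˡ (h 0)) (d 0)
pascalSum-alternating (suc n) {h} d = trans
  (pascalSum-cong n (λ i → solve 3 (λ s a b → s :* a :+ (:- s) :* b := s :* (a :- b)) refl (sign i) (h i) (h (suc i))))
  (pascalSum-alternating n d)

-- Weights with bounded sum and the central term of a vanishing difference.

-- decay (suc j) = 2 / ((j + 1)(j + 2)) telescopes and is at least 1 / (j + 1)².
decay : ℕ → ℚ
decay zero    = 0ℚ
decay (suc j) = ι 2 ℚ.* (recip j ℚ.- recip (suc j))

recip-diff : ∀ j → recip j ℚ.- recip (suc j) ≡ recip j ℚ.* recip (suc j)
recip-diff j = begin
  r ℚ.- r'
    ≡⟨ solve 2 (λ r r' → r :- r' := con 1ℚ :* r :- con 1ℚ :* r') refl r r' ⟩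
  1ℚ ℚ.* r ℚ.- 1ℚ ℚ.* r'
    ≡⟨ cong₂ (λ x y → x ℚ.* r ℚ.- y ℚ.* r') (sym (ι*recip (suc j))) (sym (ι*recip j)) ⟩
  ((1ℚ ℚ.+ a) ℚ.* r') ℚ.* r ℚ.- (a ℚ.* r) ℚ.* r'
    ≡⟨ solve 3 (λ a r r' → ((con 1ℚ :+ a) :* r') :* r :- (a :* r) :* r' := r :* r') refl a r r' ⟩
  r ℚ.* r' ∎
  where
  open ≡-Reasoning
  r r' a : ℚ
  r  = recip j
  r' = recip (suc j)
  a  = ι (suc j)

decay-nonNeg : ∀ j → 0ℚ ℚ.≤ decay j
decay-nonNeg zero    = ℚ.≤-refl
decay-nonNeg (suc j) = 0≤* (ι-nonNeg 2) (subst (0ℚ ℚ.≤_) (sym (recip-diff j)) (0≤* (recip-nonNeg j) (recip-nonNeg (suc j))))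

1≤decay*j² : ∀ j → 1ℚ ℚ.≤ decay (suc j) ℚ.* (ι (suc j) ℚ.* ι (suc j))
1≤decay*j² j = begin
  1ℚ                         ≡⟨ ι*recip (suc j) ⟨
  (1ℚ ℚ.+ a) ℚ.* r'          ≤⟨ *-monoʳ (recip-nonNeg (suc j)) (ℚ.+-monoˡ-≤ a (ι-mono {1} {suc j} (s≤s z≤n))) ⟩
  (a ℚ.+ a) ℚ.* r'           ≡⟨ solve 2 (λ a r' → (a :+ a) :* r' := con (ι 2) :* con 1ℚ :* r' :* a) refl a r' ⟩
  ι 2 ℚ.* 1ℚ ℚ.* r' ℚ.* a    ≡⟨ cong (λ z → ι 2 ℚ.* z ℚ.* r' ℚ.* a) (ι*recip j) ⟨
  ι 2 ℚ.* (a ℚ.* r) ℚ.* r' ℚ.* a ≡⟨ solve 3 (λ a r r' → con (ι 2) :* (a :* r) :* r' :* a := con (ι 2) :* (r :* r') :* (a :* a)) refl a r r' ⟩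
  ι 2 ℚ.* (r ℚ.* r') ℚ.* (a ℚ.* a) ≡⟨ cong (λ z → ι 2 ℚ.* z ℚ.* (a ℚ.* a)) (recip-diff j) ⟨
  decay (suc j) ℚ.* (a ℚ.* a)    ∎
  where
  open ℚ.≤-Reasoning
  r r' a : ℚ
  r  = recip j
  r' = recip (suc j)
  a  = ι (suc j)

decay-telescopes : ∀ j → decay (suc j) ℚ.+ ι 2 ℚ.* recip (suc j) ≡ ι 2 ℚ.* recip j
decay-telescopes j = solve 2 (λ r r' → con (ι 2) :* (r :- r') :+ con (ι 2) :* r' := con (ι 2) :* r) refl (recip j) (recip (suc j))

sum-decay-tail : ∀ K j → sumTo K (λ i → decay (suc (j + i))) ℚ.≤ ι 2 ℚ.* recip j
sum-decay-tail zero    j = 0≤* (ι-nonNeg 2) (recip-nonNeg j)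
sum-decay-tail (suc K) j = begin
  decay (suc (j + 0)) ℚ.+ sumTo K (λ i → decay (suc (j + suc i)))
    ≡⟨ cong₂ ℚ._+_ (cong (decay ∘ suc) (ℕ.+-identityʳ j)) (sumTo-cong K (λ i → cong (decay ∘ suc) (ℕ.+-suc j i))) ⟩
  decay (suc j) ℚ.+ sumTo K (λ i → decay (suc (suc j + i)))
    ≤⟨ ℚ.+-monoʳ-≤ (decay (suc j)) (sum-decay-tail K (suc j)) ⟩
  decay (suc j) ℚ.+ ι 2 ℚ.* recip (suc j)
    ≡⟨ decay-telescopes j ⟩
  ι 2 ℚ.* recip j ∎
  where open ℚ.≤-Reasoning

-- Each side of `N` contributes at most 2 by telescoping. The extra 2 / (N + 1) is what the finite
-- left side falls short of 2; with it the induction on `N` is exact.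
sum-decay-dist : ∀ N K → sumTo K (λ i → decay ∣ i - N ∣) ℚ.+ ι 2 ℚ.* recip N ℚ.≤ ι 4
sum-decay-dist zero    zero    = ι-mono {2} {4} (s≤s (s≤s z≤n))
sum-decay-dist zero    (suc K) = begin
  (0ℚ ℚ.+ sumTo K (decay ∘ suc)) ℚ.+ ι 2 ℚ.* recip 0 ≡⟨ cong (ℚ._+ ι 2 ℚ.* recip 0) (ℚ.+-identityˡ (sumTo K (decay ∘ suc))) ⟩
  sumTo K (decay ∘ suc) ℚ.+ ι 2 ℚ.* recip 0 ≤⟨ ℚ.+-monoˡ-≤ (ι 2 ℚ.* recip 0) (sum-decay-tail K 0) ⟩
  ι 2 ℚ.* recip 0 ℚ.+ ι 2 ℚ.* recip 0   ≡⟨⟩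
  ι 4 ∎
  where open ℚ.≤-Reasoning
sum-decay-dist (suc N) zero    = ℚ.≤-trans (ℚ.+-monoʳ-≤ 0ℚ 2recip-decreases) (sum-decay-dist N zero)
  where
  2recip-decreases : ι 2 ℚ.* recip (suc N) ℚ.≤ ι 2 ℚ.* recip N
  2recip-decreases = 0≤q-p⇒p≤q (subst (0ℚ ℚ.≤_) (solve 2 (λ r r' → con (ι 2) :* (r :- r') := con (ι 2) :* r :- con (ι 2) :* r') refl (recip N) (recip (suc N)))
    (decay-nonNeg (suc N)))
sum-decay-dist (suc N) (suc K) = begin
  (decay (suc N) ℚ.+ S) ℚ.+ ι 2 ℚ.* recip (suc N)
    ≡⟨ solve 3 (λ x s y → (x :+ s) :+ y := s :+ (x :+ y)) refl (decay (suc N)) S (ι 2 ℚ.* recip (suc N)) ⟩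
  S ℚ.+ (decay (suc N) ℚ.+ ι 2 ℚ.* recip (suc N))
    ≡⟨ cong (S ℚ.+_) (decay-telescopes N) ⟩
  S ℚ.+ ι 2 ℚ.* recip N
    ≤⟨ sum-decay-dist N K ⟩
  ι 4 ∎
  where
  open ℚ.≤-Reasoning
  S = sumTo K (λ i → decay ∣ i - N ∣)

sum-decay≤4 : ∀ N K → sumTo K (λ i → decay ∣ i - N ∣) ℚ.≤ ι 4
sum-decay≤4 N K = ℚ.≤-trans
  (subst (ℚ._≤ S ℚ.+ ι 2 ℚ.* recip N) (ℚ.+-identityʳ S) (ℚ.+-monoʳ-≤ S (0≤* (ι-nonNeg 2) (recip-nonNeg N))))
  (sum-decay-dist N K)
  where S = sumTo K (λ i → decay ∣ i - N ∣)

C-central-pos : ∀ N → 0 < (N + N) C N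
C-central-pos N = ℕ.≤-trans (ℕ.≤-reflexive (sym (nC0≡1 (N + N)))) (C≤central N 0)

-- The 2N-th difference of h vanishes, and its central binomial coefficient is the largest one.
central-bound : ∀ N h κ → 0ℚ ℚ.≤ κ → SeqDeg< (N + N) h →
                (∀ i → i ≤ N + N → i ≢ N → ℚ.∣ h i ∣ ℚ.≤ κ ℚ.* decay ∣ i - N ∣) → ℚ.∣ h N ∣ ℚ.≤ κ ℚ.* ι 4
central-bound N h κ 0≤κ deg bound = ℚ.*-cancelˡ-≤-pos c {{c-pos}} (begin
  c ℚ.* ℚ.∣ h N ∣                  ≡⟨ term-abs N ⟨
  ℚ.∣ a N ∣                        ≡⟨ cong ℚ.∣_∣ (trans (solve 1 (λ x → x := x :- con 0ℚ) refl (a N)) (cong (λ z → a N ℚ.- z) (sym sum≡0))) ⟩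
  ℚ.∣ a N ℚ.- sumTo K a ∣          ≤⟨ ∣term-sumTo∣≤ K N a w (s≤s (ℕ.m≤m+n N N)) (w-nonNeg N) term-bound ⟩
  sumTo K w                        ≡⟨ sumTo-* K (c ℚ.* κ) (λ i → decay ∣ i - N ∣) ⟩
  (c ℚ.* κ) ℚ.* sumTo K (λ i → decay ∣ i - N ∣) ≤⟨ *-monoˡ (0≤* (ι-nonNeg ((N + N) C N)) 0≤κ) (sum-decay≤4 N K) ⟩
  (c ℚ.* κ) ℚ.* ι 4                ≡⟨ ℚ.*-assoc c κ (ι 4) ⟩
  c ℚ.* (κ ℚ.* ι 4)                ∎)
  where
  open ℚ.≤-Reasoning
  K = suc (N + N)
  c : ℚ
  c = ι ((N + N) C N)
  a w : ℕ → ℚ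
  a i = ι ((N + N) C i) ℚ.* (sign i ℚ.* h i)
  w i = (c ℚ.* κ) ℚ.* decay ∣ i - N ∣
  c-pos : ℚ.Positive c
  c-pos with (N + N) C N | C-central-pos N
  ... | suc m | _ = ℚ.positive (ι-pos m)
  sum≡0 : sumTo K a ≡ 0ℚ
  sum≡0 = trans (sym (pascalSum-binomial (N + N) (λ i → sign i ℚ.* h i))) (pascalSum-alternating (N + N) {h} deg)
  term-abs : ∀ i → ℚ.∣ a i ∣ ≡ ι ((N + N) C i) ℚ.* ℚ.∣ h i ∣
  term-abs i = trans (ℚ.∣p*q∣≡∣p∣*∣q∣ (ι ((N + N) C i)) (sign i ℚ.* h i))
    (cong₂ ℚ._*_ (ℚ.0≤p⇒∣p∣≡p (ι-nonNeg ((N + N) C i))) (∣sign*∣ i (h i)))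
  w-nonNeg : ∀ i → 0ℚ ℚ.≤ w i
  w-nonNeg i = 0≤* (0≤* (ι-nonNeg ((N + N) C N)) 0≤κ) (decay-nonNeg ∣ i - N ∣)
  term-bound : ∀ i → i ≢ N → ℚ.∣ a i ∣ ℚ.≤ w i
  term-bound i i≢N with i ℕ.≤? N + N
  ... | no i≰2N = subst (ℚ._≤ w i)
    (sym (trans (term-abs i) (trans (cong (λ z → ι z ℚ.* ℚ.∣ h i ∣) (k>n⇒nCk≡0 (ℕ.≰⇒> i≰2N))) (ℚ.*-zeroˡ ℚ.∣ h i ∣)))) (w-nonNeg i)
  ... | yes i≤2N = begin
    ℚ.∣ a i ∣                         ≡⟨ term-abs i ⟩
    ι ((N + N) C i) ℚ.* ℚ.∣ h i ∣     ≤⟨ *-monoʳ (ℚ.0≤∣p∣ (h i)) (ι-mono (C≤central N i)) ⟩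
    c ℚ.* ℚ.∣ h i ∣                   ≤⟨ *-monoˡ (ι-nonNeg ((N + N) C N)) (bound i i≤2N i≢N) ⟩
    c ℚ.* (κ ℚ.* decay ∣ i - N ∣)         ≡⟨ ℚ.*-assoc c κ (decay ∣ i - N ∣) ⟨
    w i                               ∎

-- Univariate polynomials and quadratically spaced points.

-- Horner form, up to pointwise equality. It exhibits directly the quotient (F(t) - F(0)) / t, as
-- the `G` of one degree less.
PolyDeg≤ : ℕ → (ℚ → ℚ) → Set
PolyDeg≤ zero    F = Σ ℚ λ a → ∀ t → F t ≡ a
PolyDeg≤ (suc d) F = Σ ℚ λ a → Σ (ℚ → ℚ) λ G → PolyDeg≤ d G × (∀ t → F t ≡ a ℚ.+ t ℚ.* G t)

PolyDeg≤-cong : ∀ d {F G} → (∀ t → G t ≡ F t) → PolyDeg≤ d F → PolyDeg≤ d G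
PolyDeg≤-cong zero    eq (a , p)         = a , λ t → trans (eq t) (p t)
PolyDeg≤-cong (suc d) eq (a , H , dH , p) = a , H , dH , λ t → trans (eq t) (p t)

PolyDeg≤-zero : ∀ d → PolyDeg≤ d (λ _ → 0ℚ)
PolyDeg≤-zero zero    = 0ℚ , λ _ → refl
PolyDeg≤-zero (suc d) = 0ℚ , (λ _ → 0ℚ) , PolyDeg≤-zero d , λ t → solve 1 (λ t → con 0ℚ := con 0ℚ :+ t :* con 0ℚ) refl t

PolyDeg≤-suc : ∀ d {F} → PolyDeg≤ d F → PolyDeg≤ (suc d) F
PolyDeg≤-suc zero    (a , p) = a , (λ _ → 0ℚ) , PolyDeg≤-zero 0 , λ t → trans (p t) (solve 2 (λ a t → a := a :+ t :* con 0ℚ) refl a t)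
PolyDeg≤-suc (suc d) (a , G , dG , p) = a , G , PolyDeg≤-suc d dG , p

PolyDeg≤-mono : ∀ {d d'} {F} → d ≤ d' → PolyDeg≤ d F → PolyDeg≤ d' F
PolyDeg≤-mono {zero}  {zero}   z≤n     p = p
PolyDeg≤-mono {zero}  {suc d'} z≤n     p = PolyDeg≤-suc d' (PolyDeg≤-mono {zero} {d'} z≤n p)
PolyDeg≤-mono {suc d} {suc d'} (s≤s l) (a , G , dG , p) = a , G , PolyDeg≤-mono l dG , p

PolyDeg≤-+ : ∀ d {F G} → PolyDeg≤ d F → PolyDeg≤ d G → PolyDeg≤ d (λ t → F t ℚ.+ G t)
PolyDeg≤-+ zero    (a , p) (b , q) = a ℚ.+ b , λ t → cong₂ ℚ._+_ (p t) (q t)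
PolyDeg≤-+ (suc d) (a , H , dH , p) (b , I , dI , q) = a ℚ.+ b , (λ t → H t ℚ.+ I t) , PolyDeg≤-+ d dH dI ,
  λ t → trans (cong₂ ℚ._+_ (p t) (q t))
    (solve 5 (λ a b t h i → (a :+ t :* h) :+ (b :+ t :* i) := (a :+ b) :+ t :* (h :+ i)) refl a b t (H t) (I t))

PolyDeg≤-* : ∀ d c {F} → PolyDeg≤ d F → PolyDeg≤ d (λ t → c ℚ.* F t)
PolyDeg≤-* zero    c (a , p) = c ℚ.* a , λ t → cong (c ℚ.*_) (p t)
PolyDeg≤-* (suc d) c (a , H , dH , p) = c ℚ.* a , (λ t → c ℚ.* H t) , PolyDeg≤-* d c dH ,
  λ t → trans (cong (c ℚ.*_) (p t)) (solve 4 (λ c a t h → c :* (a :+ t :* h) := c :* a :+ t :* (c :* h)) refl c a t (H t))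

PolyDeg≤-X : ∀ d {F} → PolyDeg≤ d F → PolyDeg≤ (suc d) (λ t → t ℚ.* F t)
PolyDeg≤-X d {F} p = 0ℚ , F , p , λ t → sym (ℚ.+-identityˡ _)

PolyDeg≤-1-X : ∀ d {F} → PolyDeg≤ d F → PolyDeg≤ (suc d) (λ t → (1ℚ ℚ.- t) ℚ.* F t)
PolyDeg≤-1-X d {F} p = PolyDeg≤-cong (suc d)
  (λ t → solve 2 (λ t f → (con 1ℚ :- t) :* f := f :+ con (ℚ.- 1ℚ) :* (t :* f)) refl t (F t))
  (PolyDeg≤-+ (suc d) (PolyDeg≤-suc d p) (PolyDeg≤-* (suc d) (ℚ.- 1ℚ) (PolyDeg≤-X d p)))

-- The polynomials are evaluated at θ = node N i * σ, where σ is the reciprocal of the dimension.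
node : ℕ → ℕ → ℕ
node N i = 100 * (∣ i - N ∣ * ∣ i - N ∣) + 5

dist² : ∀ i N → (ι i ℚ.- ι N) ℚ.* (ι i ℚ.- ι N) ≡ ι (∣ i - N ∣ * ∣ i - N ∣)
dist² zero    zero    = refl
dist² zero    (suc N) = trans (solve 1 (λ x → (con 0ℚ :- x) :* (con 0ℚ :- x) := x :* x) refl (ι (suc N))) (sym (ι-* (suc N) (suc N)))
dist² (suc i) zero    = trans (solve 1 (λ x → (x :- con 0ℚ) :* (x :- con 0ℚ) := x :* x) refl (ι (suc i))) (sym (ι-* (suc i) (suc i)))
dist² (suc i) (suc N) = trans
  (solve 2 (λ x y → ((con 1ℚ :+ x) :- (con 1ℚ :+ y)) :* ((con 1ℚ :+ x) :- (con 1ℚ :+ y)) := (x :- y) :* (x :- y)) refl (ι i) (ι N))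
  (dist² i N)

ι-node : ∀ N i → ι (node N i) ≡ ι 100 ℚ.* ι (∣ i - N ∣ * ∣ i - N ∣) ℚ.+ ι 5
ι-node N i = trans (ι-+ (100 * (∣ i - N ∣ * ∣ i - N ∣)) 5) (cong (ℚ._+ ι 5) (ι-* 100 (∣ i - N ∣ * ∣ i - N ∣)))

-- A node is quadratic in `i`, so each Horner step multiplies by two linear factors and a degree d
-- in θ becomes at most 2d in `i`.
node-deg : ∀ N σ d {G} → PolyDeg≤ d G → SeqDeg< (suc (d + d)) (λ i → G (ι (node N i) ℚ.* σ))
node-deg N σ zero    (a , p) = SeqDeg<-cong 1 (λ i → sym (p (ι (node N i) ℚ.* σ))) (SeqDeg<-const 0 a)
node-deg N σ (suc d) {G} (a , H , dH , p) = subst (λ r → SeqDeg< (suc (suc r)) g) (sym (ℕ.+-suc d d))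
  (SeqDeg<-cong (suc (suc (suc (d + d)))) eq
    (SeqDeg<-+ (suc r2) {λ _ → a} {λ i → (ι 100 ℚ.* σ) ℚ.* (ℓ i ℚ.* (ℓ i ℚ.* h i)) ℚ.+ (ι 5 ℚ.* σ) ℚ.* h i}
      (SeqDeg<-const r2 a)
      (SeqDeg<-+ (suc r2) {λ i → (ι 100 ℚ.* σ) ℚ.* (ℓ i ℚ.* (ℓ i ℚ.* h i))} {λ i → (ι 5 ℚ.* σ) ℚ.* h i}
        (SeqDeg<-* (suc r2) (ι 100 ℚ.* σ) {λ i → ℓ i ℚ.* (ℓ i ℚ.* h i)}
          (SeqDeg<-linear r2 (ι N) {λ i → ℓ i ℚ.* h i} (SeqDeg<-linear (suc (d + d)) (ι N) {h} IH)))
        (SeqDeg<-* (suc r2) (ι 5 ℚ.* σ) {h} (SeqDeg<-suc r2 {h} (SeqDeg<-suc (suc (d + d)) {h} IH))))))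
  where
  r2 = suc (suc (d + d))
  g h ℓ : ℕ → ℚ
  g i = G (ι (node N i) ℚ.* σ)
  h i = H (ι (node N i) ℚ.* σ)
  ℓ i = ι i ℚ.- ι N
  IH : SeqDeg< (suc (d + d)) h
  IH = node-deg N σ d dH
  eq : ∀ i → a ℚ.+ ((ι 100 ℚ.* σ) ℚ.* (ℓ i ℚ.* (ℓ i ℚ.* h i)) ℚ.+ (ι 5 ℚ.* σ) ℚ.* h i) ≡ g i
  eq i = begin
    a ℚ.+ ((ι 100 ℚ.* σ) ℚ.* (ℓ i ℚ.* (ℓ i ℚ.* h i)) ℚ.+ (ι 5 ℚ.* σ) ℚ.* h i)
      ≡⟨ solve 6 (λ a m f s l h → a :+ ((m :* s) :* (l :* (l :* h)) :+ (f :* s) :* h) := a :+ ((m :* (l :* l) :+ f) :* s) :* h)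
           refl a (ι 100) (ι 5) σ (ℓ i) (h i) ⟩
    a ℚ.+ ((ι 100 ℚ.* (ℓ i ℚ.* ℓ i) ℚ.+ ι 5) ℚ.* σ) ℚ.* h i
      ≡⟨ cong (λ z → a ℚ.+ ((ι 100 ℚ.* z ℚ.+ ι 5) ℚ.* σ) ℚ.* h i) (dist² i N) ⟩
    a ℚ.+ ((ι 100 ℚ.* ι (∣ i - N ∣ * ∣ i - N ∣) ℚ.+ ι 5) ℚ.* σ) ℚ.* h i
      ≡⟨ cong (λ z → a ℚ.+ (z ℚ.* σ) ℚ.* h i) (ι-node N i) ⟨
    a ℚ.+ (ι (node N i) ℚ.* σ) ℚ.* h i
      ≡⟨ p (ι (node N i) ℚ.* σ) ⟨
    g i ∎
    where open ≡-Reasoning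

∣i-N∣≢0 : ∀ i N → i ≢ N → Σ ℕ λ j → ∣ i - N ∣ ≡ suc j
∣i-N∣≢0 zero    zero    i≢N = ⊥-elim (i≢N refl)
∣i-N∣≢0 zero    (suc N) i≢N = N , refl
∣i-N∣≢0 (suc i) zero    i≢N = i , refl
∣i-N∣≢0 (suc i) (suc N) i≢N = ∣i-N∣≢0 i N (i≢N ∘ cong suc)

-- With M = |F(0)|, smallness gives |F(θᵢ) - F(0)| ≤ 3M/2. Dividing by θᵢ, `h` obeys the bound of
-- `central-bound` with `κ` = 3M/2, so |h(N)| ≤ 6M. But the central node is only 5, so 5 |h(N)| =
-- 100 |F(θ_N) - F(0)| ≥ 50M, which exceeds 30M.
no-jump : ∀ d F σ → PolyDeg≤ (suc d) F → 0ℚ ℚ.< ℚ.∣ F 0ℚ ∣ →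
          ¬ (∀ i → i ≤ suc d + suc d → ℚ.∣ F (ι (node (suc d) i) ℚ.* σ) ∣ ℚ.≤ ½ ℚ.* ℚ.∣ F 0ℚ ∣)
no-jump d F σ (a , G , dG , F≡) 0<M small = ℚ.<-irrefl refl (begin-strict
  ι 30 ℚ.* M               ≡⟨ solve 1 (λ m → con (ι 30) :* m := con (ι 30) :* m :+ con 0ℚ) refl M ⟩
  ι 30 ℚ.* M ℚ.+ 0ℚ        <⟨ ℚ.+-monoʳ-< (ι 30 ℚ.* M) (ℚ.<-≤-trans 0<M (subst (ℚ._≤ ι 20 ℚ.* M) (ℚ.*-identityˡ M) (*-monoʳ 0≤M (ι-mono {1} {20} (s≤s z≤n))))) ⟩
  ι 30 ℚ.* M ℚ.+ ι 20 ℚ.* M ≡⟨ solve 1 (λ m → con (ι 30) :* m :+ con (ι 20) :* m := con (ι 100) :* (m :+ :- (con ½ :* m))) refl M ⟩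
  ι 100 ℚ.* (M ℚ.- ½ ℚ.* M) ≤⟨ *-monoˡ (ι-nonNeg 100) lower ⟩
  ι 100 ℚ.* ℚ.∣ F (θ N) ℚ.- a ∣ ≡⟨ scaled N ⟨
  ι (node N N) ℚ.* ℚ.∣ h N ∣ ≡⟨ cong (λ z → ι (100 * (z * z) + 5) ℚ.* ℚ.∣ h N ∣) (ℕ.∣n-n∣≡0 N) ⟩
  ι 5 ℚ.* ℚ.∣ h N ∣         ≤⟨ *-monoˡ (ι-nonNeg 5) (central-bound N h κ 0≤κ h-deg outer) ⟩
  ι 5 ℚ.* (κ ℚ.* ι 4)       ≡⟨ solve 1 (λ m → con (ι 5) :* ((con (ι 3 ℚ.* ½) :* m) :* con (ι 4)) := con (ι 30) :* m) refl M ⟩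
  ι 30 ℚ.* M ∎)
  where
  open ℚ.≤-Reasoning
  N = suc d
  M κ : ℚ
  M = ℚ.∣ F 0ℚ ∣
  κ = (ι 3 ℚ.* ½) ℚ.* M
  θ h : ℕ → ℚ
  θ i = ι (node N i) ℚ.* σ
  h i = (ι 100 ℚ.* σ) ℚ.* G (θ i)
  0≤M : 0ℚ ℚ.≤ M
  0≤M = ℚ.<⇒≤ 0<M
  0≤κ : 0ℚ ℚ.≤ κ
  0≤κ = 0≤* (ℚ.nonNegative⁻¹ (ι 3 ℚ.* ½)) 0≤M
  F0≡a : F 0ℚ ≡ a
  F0≡a = trans (F≡ 0ℚ) (solve 2 (λ a g → a :+ con 0ℚ :* g := a) refl a (G 0ℚ))
  -- `G` has degree d = N - 1, so `h` has degree at most 2N - 2.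
  h-deg : SeqDeg< (N + N) h
  h-deg = subst (λ r → SeqDeg< (suc r) h) (sym (ℕ.+-suc d d))
    (SeqDeg<-suc (suc (d + d)) {h} (SeqDeg<-* (suc (d + d)) (ι 100 ℚ.* σ) {G ∘ θ} (node-deg N σ d dG)))
  scaled : ∀ i → ι (node N i) ℚ.* ℚ.∣ h i ∣ ≡ ι 100 ℚ.* ℚ.∣ F (θ i) ℚ.- a ∣
  scaled i = begin-equality
    ι (node N i) ℚ.* ℚ.∣ h i ∣           ≡⟨ cong (ℚ._* ℚ.∣ h i ∣) (ℚ.0≤p⇒∣p∣≡p (ι-nonNeg (node N i))) ⟨
    ℚ.∣ ι (node N i) ∣ ℚ.* ℚ.∣ h i ∣     ≡⟨ ℚ.∣p*q∣≡∣p∣*∣q∣ (ι (node N i)) (h i) ⟨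
    ℚ.∣ ι (node N i) ℚ.* h i ∣           ≡⟨ cong ℚ.∣_∣ (solve 5 (λ n c s g a → n :* ((c :* s) :* g) := c :* ((a :+ (n :* s) :* g) :- a)) refl (ι (node N i)) (ι 100) σ (G (θ i)) a) ⟩
    ℚ.∣ ι 100 ℚ.* ((a ℚ.+ θ i ℚ.* G (θ i)) ℚ.- a) ∣ ≡⟨ cong (λ z → ℚ.∣ ι 100 ℚ.* (z ℚ.- a) ∣) (F≡ (θ i)) ⟨
    ℚ.∣ ι 100 ℚ.* (F (θ i) ℚ.- a) ∣      ≡⟨ ℚ.∣p*q∣≡∣p∣*∣q∣ (ι 100) (F (θ i) ℚ.- a) ⟩
    ι 100 ℚ.* ℚ.∣ F (θ i) ℚ.- a ∣        ∎
  lower : M ℚ.- ½ ℚ.* M ℚ.≤ ℚ.∣ F (θ N) ℚ.- a ∣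
  lower = begin
    M ℚ.- ½ ℚ.* M                                   ≤⟨ ℚ.+-monoˡ-≤ (ℚ.- (½ ℚ.* M)) triangle ⟩
    (ℚ.∣ F (θ N) ℚ.- a ∣ ℚ.+ ½ ℚ.* M) ℚ.- ½ ℚ.* M   ≡⟨ solve 2 (λ x y → (x :+ y) :- y := x) refl ℚ.∣ F (θ N) ℚ.- a ∣ (½ ℚ.* M) ⟩
    ℚ.∣ F (θ N) ℚ.- a ∣                             ∎
    where
    triangle : M ℚ.≤ ℚ.∣ F (θ N) ℚ.- a ∣ ℚ.+ ½ ℚ.* M
    triangle = begin
      ℚ.∣ F 0ℚ ∣                              ≡⟨ cong ℚ.∣_∣ F0≡a ⟩
      ℚ.∣ a ∣                                 ≡⟨ ℚ.∣-p∣≡∣p∣ a ⟨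
      ℚ.∣ ℚ.- a ∣                             ≡⟨ cong ℚ.∣_∣ (solve 2 (λ a f → :- a := (f :- a) :- f) refl a (F (θ N))) ⟩
      ℚ.∣ (F (θ N) ℚ.- a) ℚ.- F (θ N) ∣       ≤⟨ ℚ.∣p-q∣≤∣p∣+∣q∣ (F (θ N) ℚ.- a) (F (θ N)) ⟩
      ℚ.∣ F (θ N) ℚ.- a ∣ ℚ.+ ℚ.∣ F (θ N) ∣   ≤⟨ ℚ.+-monoʳ-≤ ℚ.∣ F (θ N) ℚ.- a ∣ (small N (ℕ.m≤m+n N N)) ⟩
      ℚ.∣ F (θ N) ℚ.- a ∣ ℚ.+ ½ ℚ.* M         ∎
  outer : ∀ i → i ≤ N + N → i ≢ N → ℚ.∣ h i ∣ ℚ.≤ κ ℚ.* decay ∣ i - N ∣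
  outer i i≤2N i≢N = subst (λ z → ℚ.∣ h i ∣ ℚ.≤ κ ℚ.* decay z) (sym eq) (ℚ.*-cancelˡ-≤-pos (ι 100) (begin
    ι 100 ℚ.* ℚ.∣ h i ∣                                   ≡⟨ solve 1 (λ x → x := con 1ℚ :* x) refl (ι 100 ℚ.* ℚ.∣ h i ∣) ⟩
    1ℚ ℚ.* (ι 100 ℚ.* ℚ.∣ h i ∣)                          ≤⟨ *-monoʳ (0≤* (ι-nonNeg 100) (ℚ.0≤∣p∣ (h i))) (1≤decay*j² j) ⟩
    (decay (suc j) ℚ.* J²) ℚ.* (ι 100 ℚ.* ℚ.∣ h i ∣)          ≡⟨ solve 4 (λ w j c h → (w :* j) :* (c :* h) := w :* ((c :* j) :* h)) refl (decay (suc j)) J² (ι 100) ℚ.∣ h i ∣ ⟩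
    decay (suc j) ℚ.* ((ι 100 ℚ.* J²) ℚ.* ℚ.∣ h i ∣)          ≤⟨ *-monoˡ (decay-nonNeg (suc j)) (*-monoʳ (ℚ.0≤∣p∣ (h i)) node≥) ⟩
    decay (suc j) ℚ.* (ι (node N i) ℚ.* ℚ.∣ h i ∣)            ≡⟨ cong (decay (suc j) ℚ.*_) (scaled i) ⟩
    decay (suc j) ℚ.* (ι 100 ℚ.* ℚ.∣ F (θ i) ℚ.- a ∣)         ≤⟨ *-monoˡ (decay-nonNeg (suc j)) (*-monoˡ (ι-nonNeg 100) upper) ⟩
    decay (suc j) ℚ.* (ι 100 ℚ.* κ)                           ≡⟨ solve 3 (λ w c k → w :* (c :* k) := c :* (k :* w)) refl (decay (suc j)) (ι 100) κ ⟩
    ι 100 ℚ.* (κ ℚ.* decay (suc j))                           ∎))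
    where
    j : ℕ
    j = proj₁ (∣i-N∣≢0 i N i≢N)
    eq : ∣ i - N ∣ ≡ suc j
    eq = proj₂ (∣i-N∣≢0 i N i≢N)
    J² : ℚ
    J² = ι (suc j) ℚ.* ι (suc j)
    node≥ : ι 100 ℚ.* J² ℚ.≤ ι (node N i)
    node≥ = begin
      ι 100 ℚ.* J²                                  ≡⟨ cong (ι 100 ℚ.*_) (ι-* (suc j) (suc j)) ⟨
      ι 100 ℚ.* ι (suc j * suc j)                   ≡⟨ ι-* 100 (suc j * suc j) ⟨
      ι (100 * (suc j * suc j))                     ≤⟨ ι-mono (ℕ.m≤m+n (100 * (suc j * suc j)) 5) ⟩
      ι (100 * (suc j * suc j) + 5)                 ≡⟨ cong (λ z → ι (100 * (z * z) + 5)) eq ⟨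
      ι (node N i)                                  ∎
    upper : ℚ.∣ F (θ i) ℚ.- a ∣ ℚ.≤ κ
    upper = begin
      ℚ.∣ F (θ i) ℚ.- a ∣          ≤⟨ ℚ.∣p-q∣≤∣p∣+∣q∣ (F (θ i)) a ⟩
      ℚ.∣ F (θ i) ∣ ℚ.+ ℚ.∣ a ∣    ≡⟨ cong (λ z → ℚ.∣ F (θ i) ∣ ℚ.+ ℚ.∣ z ∣) F0≡a ⟨
      ℚ.∣ F (θ i) ∣ ℚ.+ M          ≤⟨ ℚ.+-monoˡ-≤ M (small i i≤2N) ⟩
      ½ ℚ.* M ℚ.+ M                ≡⟨ solve 1 (λ m → con ½ :* m :+ m := con (ι 3 ℚ.* ½) :* m) refl M ⟩
      κ                            ∎

-- Polynomials on a subcube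

true≢false : true ≢ false
true≢false ()

≢⇒≡not : ∀ {a b} → a ≢ b → a ≡ not b
≢⇒≡not {true}  {true}  a≢b = ⊥-elim (a≢b refl)
≢⇒≡not {true}  {false} a≢b = refl
≢⇒≡not {false} {true}  a≢b = refl
≢⇒≡not {false} {false} a≢b = ⊥-elim (a≢b refl)

not≢ : ∀ {b} → not b ≢ b
not≢ {true}  ()
not≢ {false} ()

-- The expectation of g at the point obtained from y by flipping each bit of T independently with probability θ.
E : ∀ {n} → Input n → Input n → ℚ → (Input n → ℚ) → ℚ
E {zero}  y T θ g = g (λ ())
E {suc n} y T θ g =
  if T zero
  then (1ℚ ℚ.- θ) ℚ.* E (y ∘ suc) (T ∘ suc) θ (λ x → g (y zero ◂ x))
       ℚ.+ θ ℚ.* E (y ∘ suc) (T ∘ suc) θ (λ x → g (not (y zero) ◂ x))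
  else E (y ∘ suc) (T ∘ suc) θ (λ x → g (y zero ◂ x))

-- Inputs are functions, and pointwise equal ones need not be identical; this says that `g` does not
-- tell them apart.
Extensional : ∀ {n} {A : Set} → (Input n → A) → Set
Extensional g = ∀ x x' → (∀ i → x i ≡ x' i) → g x ≡ g x'

◂-cong : ∀ {n b} {x x' : Input n} → (∀ i → x i ≡ x' i) → ∀ i → (b ◂ x) i ≡ (b ◂ x') i
◂-cong eq zero    = refl
◂-cong eq (suc i) = eq i

◂-η : ∀ {n} (x : Input (suc n)) i → (x zero ◂ (x ∘ suc)) i ≡ x i
◂-η x zero    = refl
◂-η x (suc i) = refl

monomial-ext : ∀ {n} (S : Input n) → Extensional (monomial S)
monomial-ext {zero}  S x x' eq = refl
monomial-ext {suc n} S x x' eq = cong₂ ℚ._*_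
  (cong (λ b → if S zero then (if b then 1ℚ else 0ℚ) else 1ℚ) (eq zero))
  (monomial-ext (S ∘ suc) (x ∘ suc) (x' ∘ suc) (eq ∘ suc))

-- The points at which sumCube evaluates its argument are anonymous in its definition, and without function
-- extensionality they cannot be replaced by points written here; unification names them.
sumCube-point : (g : Input 0 → ℚ) → Σ (Input 0) λ o → sumCube 0 g ≡ g o
sumCube-point g = _ , refl

sumCube-faces : ∀ n (g : Input (suc n) → ℚ) → Σ (Input n → Input (suc n)) λ l → Σ (Input n → Input (suc n)) λ u →
                sumCube (suc n) g ≡ sumCube n (λ x → g (l x)) ℚ.+ sumCube n (λ x → g (u x))
sumCube-faces n g = _ , _ , refl

origin : Input 0
origin = proj₁ (sumCube-point (λ _ → 0ℚ))

lower upper : ∀ {n} → Input n → Input (suc n)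
lower {n} = proj₁ (sumCube-faces n (λ _ → 0ℚ))
upper {n} = proj₁ (proj₂ (sumCube-faces n (λ _ → 0ℚ)))

sumCube-cong : ∀ n {g h : Input n → ℚ} → (∀ x → g x ≡ h x) → sumCube n g ≡ sumCube n h
sumCube-cong zero    {g} {h} eq = eq origin
sumCube-cong (suc n) {g} {h} eq = cong₂ ℚ._+_ (sumCube-cong n (eq ∘ lower)) (sumCube-cong n (eq ∘ upper))

eval-ext : ∀ {n} (c : Poly n) → Extensional (eval c)
eval-ext {n} c x x' eq = sumCube-cong n (λ S → cong (c S ℚ.*_) (monomial-ext S x x' eq))

E-cong : ∀ {n} (y T : Input n) θ {g h} → (∀ x → g x ≡ h x) → E y T θ g ≡ E y T θ h
E-cong {zero}  y T θ eq = eq _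
E-cong {suc n} y T θ eq with T zero
... | true  = cong₂ (λ u v → (1ℚ ℚ.- θ) ℚ.* u ℚ.+ θ ℚ.* v)
                (E-cong (y ∘ suc) (T ∘ suc) θ (λ x → eq _)) (E-cong (y ∘ suc) (T ∘ suc) θ (λ x → eq _))
... | false = E-cong (y ∘ suc) (T ∘ suc) θ (λ x → eq _)

E-+ : ∀ {n} (y T : Input n) θ g h → E y T θ (λ x → g x ℚ.+ h x) ≡ E y T θ g ℚ.+ E y T θ h
E-+ {zero}  y T θ g h = refl
E-+ {suc n} y T θ g h with T zero
... | false = E-+ (y ∘ suc) (T ∘ suc) θ (λ x → g (y zero ◂ x)) (λ x → h (y zero ◂ x))
... | true  = trans
  (cong₂ (λ u v → (1ℚ ℚ.- θ) ℚ.* u ℚ.+ θ ℚ.* v)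
    (E-+ (y ∘ suc) (T ∘ suc) θ (λ x → g (y zero ◂ x)) (λ x → h (y zero ◂ x)))
    (E-+ (y ∘ suc) (T ∘ suc) θ (λ x → g (not (y zero) ◂ x)) (λ x → h (not (y zero) ◂ x))))
  (solve 6 (λ s t a b c d → s :* (a :+ b) :+ t :* (c :+ d) := (s :* a :+ t :* c) :+ (s :* b :+ t :* d)) refl (1ℚ ℚ.- θ) θ _ _ _ _)

E-* : ∀ {n} (y T : Input n) θ c g → E y T θ (λ x → c ℚ.* g x) ≡ c ℚ.* E y T θ g
E-* {zero}  y T θ c g = refl
E-* {suc n} y T θ c g with T zero
... | false = E-* (y ∘ suc) (T ∘ suc) θ c (λ x → g (y zero ◂ x))
... | true  = trans
  (cong₂ (λ u v → (1ℚ ℚ.- θ) ℚ.* u ℚ.+ θ ℚ.* v)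
    (E-* (y ∘ suc) (T ∘ suc) θ c (λ x → g (y zero ◂ x)))
    (E-* (y ∘ suc) (T ∘ suc) θ c (λ x → g (not (y zero) ◂ x))))
  (solve 5 (λ s t c a b → s :* (c :* a) :+ t :* (c :* b) := c :* (s :* a :+ t :* b)) refl (1ℚ ℚ.- θ) θ c _ _)

E-sumCube : ∀ {n} (y T : Input n) θ m (H : Input m → Input n → ℚ) →
            E y T θ (λ x → sumCube m (λ S → H S x)) ≡ sumCube m (λ S → E y T θ (H S))
E-sumCube y T θ zero    H = refl
E-sumCube y T θ (suc m) H = trans
  (E-+ y T θ (λ x → sumCube m (λ S → H (lower S) x)) (λ x → sumCube m (λ S → H (upper S) x)))
  (cong₂ ℚ._+_ (E-sumCube y T θ m (H ∘ lower)) (E-sumCube y T θ m (H ∘ upper)))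

E-0 : ∀ {n} (y T : Input n) g → Extensional g → E y T 0ℚ g ≡ g y
E-0 {zero}  y T g ext = ext _ _ (λ ())
E-0 {suc n} y T g ext with T zero
... | true  = trans (solve 2 (λ a b → (con 1ℚ :- con 0ℚ) :* a :+ con 0ℚ :* b := a) refl
                  (E (y ∘ suc) (T ∘ suc) 0ℚ (λ x → g (y zero ◂ x))) (E (y ∘ suc) (T ∘ suc) 0ℚ (λ x → g (not (y zero) ◂ x))))
                (trans (E-0 (y ∘ suc) (T ∘ suc) _ (λ x x' eq → ext _ _ (◂-cong eq))) (ext _ _ (◂-η y)))
... | false = trans (E-0 (y ∘ suc) (T ∘ suc) _ (λ x x' eq → ext _ _ (◂-cong eq))) (ext _ _ (◂-η y))

PolyDeg≤-sumCube : ∀ d m (H : Input m → ℚ → ℚ) → (∀ S → PolyDeg≤ d (H S)) → PolyDeg≤ d (λ t → sumCube m (λ S → H S t))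
PolyDeg≤-sumCube d zero    H p = p origin
PolyDeg≤-sumCube d (suc m) H p = PolyDeg≤-+ d
  (PolyDeg≤-sumCube d m (H ∘ lower) (p ∘ lower)) (PolyDeg≤-sumCube d m (H ∘ upper) (p ∘ upper))

-- A coordinate outside `S` averages out, since its two weights sum to 1; a coordinate in `S`
-- contributes a factor of degree at most one in θ.
E-monomial-deg : ∀ {n} (y T S : Input n) → PolyDeg≤ (weight S) (λ θ → E y T θ (monomial S))
E-monomial-deg {zero}  y T S = 1ℚ , λ _ → refl
E-monomial-deg {suc n} y T S = PolyDeg≤-cong (weight S) eq deg
  where
  factor : Bool → ℚ
  factor b = if S zero then (if b then 1ℚ else 0ℚ) else 1ℚ
  rest : ℚ → ℚ
  rest θ = E (y ∘ suc) (T ∘ suc) θ (monomial (S ∘ suc))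
  IH : PolyDeg≤ (weight (S ∘ suc)) rest
  IH = E-monomial-deg (y ∘ suc) (T ∘ suc) (S ∘ suc)
  total : ℚ → ℚ
  total θ = if T zero
    then (1ℚ ℚ.- θ) ℚ.* (factor (y zero) ℚ.* rest θ) ℚ.+ θ ℚ.* (factor (not (y zero)) ℚ.* rest θ)
    else factor (y zero) ℚ.* rest θ
  pull : ∀ θ b → E (y ∘ suc) (T ∘ suc) θ (λ x → monomial S (b ◂ x)) ≡ factor b ℚ.* rest θ
  pull θ b = E-* (y ∘ suc) (T ∘ suc) θ (factor b) (monomial (S ∘ suc))
  eq : ∀ θ → E y T θ (monomial S) ≡ total θ
  eq θ with T zero
  ... | true  = cong₂ (λ u v → (1ℚ ℚ.- θ) ℚ.* u ℚ.+ θ ℚ.* v) (pull θ (y zero)) (pull θ (not (y zero)))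
  ... | false = pull θ (y zero)
  deg : PolyDeg≤ (weight S) total
  deg with T zero | S zero
  ... | false | true  = PolyDeg≤-suc _ (PolyDeg≤-* _ (if y zero then 1ℚ else 0ℚ) IH)
  ... | false | false = PolyDeg≤-* _ 1ℚ IH
  ... | true  | false = PolyDeg≤-cong _ (λ θ → solve 2 (λ t f → (con 1ℚ :- t) :* (con 1ℚ :* f) :+ t :* (con 1ℚ :* f) := f) refl θ (rest θ)) IH
  ... | true  | true  = PolyDeg≤-+ (suc w)
    (PolyDeg≤-1-X w (PolyDeg≤-* w (if y zero then 1ℚ else 0ℚ) IH))
    (PolyDeg≤-X w (PolyDeg≤-* w (if not (y zero) then 1ℚ else 0ℚ) IH))
    where w = weight (S ∘ suc)

E-eval-deg : ∀ {n} (y T : Input n) c d → DegLe c d → PolyDeg≤ d (λ θ → E y T θ (eval c))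
E-eval-deg {n} y T c d deg = PolyDeg≤-cong d
  (λ θ → E-sumCube y T θ n (λ S x → c S ℚ.* monomial S x))
  (PolyDeg≤-sumCube d n (λ S θ → E y T θ (λ x → c S ℚ.* monomial S x)) term)
  where
  term : ∀ S → PolyDeg≤ d (λ θ → E y T θ (λ x → c S ℚ.* monomial S x))
  -- `DegLe` restricts only the monomials with nonzero coefficient; the others vanish.
  term S with c S ℚ.≟ 0ℚ
  ... | yes c≡0 = PolyDeg≤-cong d
    (λ θ → trans (E-* y T θ (c S) (monomial S)) (trans (cong (ℚ._* E y T θ (monomial S)) c≡0) (ℚ.*-zeroˡ (E y T θ (monomial S))))) (PolyDeg≤-zero d)
  ... | no c≢0  = PolyDeg≤-cong d (λ θ → E-* y T θ (c S) (monomial S))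
    (PolyDeg≤-* d (c S) (PolyDeg≤-mono (deg S c≢0) (E-monomial-deg y T S)))

-- Size of the expectation and the dimension bound.

-- The probability that no bit of `T` is flipped, (1 - θ) to the power `weight T`.
stay : ∀ {n} → Input n → ℚ → ℚ
stay {zero}  T θ = 1ℚ
stay {suc n} T θ = (if T zero then 1ℚ ℚ.- θ else 1ℚ) ℚ.* stay (T ∘ suc) θ

InCube : ∀ {n} → Input n → Input n → Input n → Set
InCube y T x = ∀ i → T i ≡ false → x i ≡ y i

module _ (θ : ℚ) (0≤θ : 0ℚ ℚ.≤ θ) (θ≤1 : θ ℚ.≤ 1ℚ) where

  0≤1-θ : 0ℚ ℚ.≤ 1ℚ ℚ.- θ
  0≤1-θ = p≤q⇒0≤q-p θ≤1

  stay-nonNeg : ∀ {n} (T : Input n) → 0ℚ ℚ.≤ stay T θ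
  stay-nonNeg {zero}  T = 0≤1
  stay-nonNeg {suc n} T with T zero
  ... | true  = 0≤* 0≤1-θ (stay-nonNeg (T ∘ suc))
  ... | false = 0≤* 0≤1 (stay-nonNeg (T ∘ suc))

  -- Since (1 - θ)(1 + (1 + w)θ) = 1 + wθ - (1 + w)θ², another factor 1 - θ never increases the
  -- product.
  bernoulli : ∀ {n} (T : Input n) → stay T θ ℚ.* (1ℚ ℚ.+ ι (weight T) ℚ.* θ) ℚ.≤ 1ℚ
  bernoulli {zero}  T = ℚ.≤-reflexive (solve 1 (λ t → con 1ℚ :* (con 1ℚ :+ con 0ℚ :* t) := con 1ℚ) refl θ)
  bernoulli {suc n} T with T zero
  ... | false = subst (λ s → s ℚ.* (1ℚ ℚ.+ ι (weight (T ∘ suc)) ℚ.* θ) ℚ.≤ 1ℚ) (sym (ℚ.*-identityˡ (stay (T ∘ suc) θ))) (bernoulli (T ∘ suc))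
  ... | true  = begin
    ((1ℚ ℚ.- θ) ℚ.* s) ℚ.* (1ℚ ℚ.+ (1ℚ ℚ.+ w) ℚ.* θ)
      ≡⟨ solve 3 (λ s t w → ((con 1ℚ :- t) :* s) :* (con 1ℚ :+ (con 1ℚ :+ w) :* t) := s :* (con 1ℚ :+ w :* t) :- s :* ((con 1ℚ :+ w) :* (t :* t))) refl s θ w ⟩
    s ℚ.* (1ℚ ℚ.+ w ℚ.* θ) ℚ.- s ℚ.* ((1ℚ ℚ.+ w) ℚ.* (θ ℚ.* θ))
      ≤⟨ 0≤q-p⇒p≤q (subst (0ℚ ℚ.≤_) (solve 2 (λ a b → b := a :- (a :- b)) refl (s ℚ.* (1ℚ ℚ.+ w ℚ.* θ)) (s ℚ.* ((1ℚ ℚ.+ w) ℚ.* (θ ℚ.* θ))))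
           (0≤* (stay-nonNeg (T ∘ suc)) (0≤* (ι-nonNeg (suc (weight (T ∘ suc)))) (0≤* 0≤θ 0≤θ)))) ⟩
    s ℚ.* (1ℚ ℚ.+ w ℚ.* θ)
      ≤⟨ bernoulli (T ∘ suc) ⟩
    1ℚ ∎
    where
    open ℚ.≤-Reasoning
    s w : ℚ
    s = stay (T ∘ suc) θ
    w = ι (weight (T ∘ suc))

  ∣mix∣≤ : ∀ {u v A B} → ℚ.∣ u ∣ ℚ.≤ A → ℚ.∣ v ∣ ℚ.≤ B → ℚ.∣ (1ℚ ℚ.- θ) ℚ.* u ℚ.+ θ ℚ.* v ∣ ℚ.≤ (1ℚ ℚ.- θ) ℚ.* A ℚ.+ θ ℚ.* B
  ∣mix∣≤ {u} {v} {A} {B} u≤ v≤ = begin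
    ℚ.∣ (1ℚ ℚ.- θ) ℚ.* u ℚ.+ θ ℚ.* v ∣                ≤⟨ ℚ.∣p+q∣≤∣p∣+∣q∣ ((1ℚ ℚ.- θ) ℚ.* u) (θ ℚ.* v) ⟩
    ℚ.∣ (1ℚ ℚ.- θ) ℚ.* u ∣ ℚ.+ ℚ.∣ θ ℚ.* v ∣          ≡⟨ cong₂ ℚ._+_ (ℚ.∣p*q∣≡∣p∣*∣q∣ (1ℚ ℚ.- θ) u) (ℚ.∣p*q∣≡∣p∣*∣q∣ θ v) ⟩
    ℚ.∣ 1ℚ ℚ.- θ ∣ ℚ.* ℚ.∣ u ∣ ℚ.+ ℚ.∣ θ ∣ ℚ.* ℚ.∣ v ∣ ≡⟨ cong₂ (λ a b → a ℚ.* ℚ.∣ u ∣ ℚ.+ b ℚ.* ℚ.∣ v ∣) (ℚ.0≤p⇒∣p∣≡p 0≤1-θ) (ℚ.0≤p⇒∣p∣≡p 0≤θ) ⟩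
    (1ℚ ℚ.- θ) ℚ.* ℚ.∣ u ∣ ℚ.+ θ ℚ.* ℚ.∣ v ∣          ≤⟨ ℚ.+-mono-≤ (*-monoˡ 0≤1-θ u≤) (*-monoˡ 0≤θ v≤) ⟩
    (1ℚ ℚ.- θ) ℚ.* A ℚ.+ θ ℚ.* B                      ∎
    where open ℚ.≤-Reasoning

  ∣E∣≤ : ∀ {n} (y T : Input n) g B → (∀ x → InCube y T x → ℚ.∣ g x ∣ ℚ.≤ B) → ℚ.∣ E y T θ g ∣ ℚ.≤ B
  ∣E∣≤ {zero}  y T g B le = le _ (λ ())
  ∣E∣≤ {suc n} y T g B le with T zero in eq
  ... | false = ∣E∣≤ (y ∘ suc) (T ∘ suc) (λ x → g (y zero ◂ x)) B
                  (λ x x∈ → le (y zero ◂ x) λ { zero _ → refl ; (suc i) → x∈ i })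
  ... | true  = ℚ.≤-trans (∣mix∣≤ (side (y zero)) (side (not (y zero))))
                  (ℚ.≤-reflexive (solve 2 (λ t b → (con 1ℚ :- t) :* b :+ t :* b := b) refl θ B))
    where
    side : ∀ b → ℚ.∣ E (y ∘ suc) (T ∘ suc) θ (λ x → g (b ◂ x)) ∣ ℚ.≤ B
    side b = ∣E∣≤ (y ∘ suc) (T ∘ suc) (λ x → g (b ◂ x)) B
      (λ x x∈ → le (b ◂ x) λ { zero T0≡false → ⊥-elim (true≢false (trans (sym eq) T0≡false)) ; (suc i) → x∈ i })

  -- The corner is hit with probability `stay T θ` and contributes at most `M` there; all other
  -- points contribute at most `B` on average.
  ∣E∣≤-corner : ∀ {n} (y T : Input n) g B M → Extensional g → 0ℚ ℚ.≤ B →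
                (∀ x → InCube y T x → ¬ (∀ i → x i ≡ y i) → ℚ.∣ g x ∣ ℚ.≤ B) → ℚ.∣ g y ∣ ℚ.≤ M →
                ℚ.∣ E y T θ g ∣ ℚ.≤ B ℚ.+ stay T θ ℚ.* M
  ∣E∣≤-corner {zero}  y T g B M ext 0≤B le at-y = begin
    ℚ.∣ g (λ ()) ∣   ≡⟨ cong ℚ.∣_∣ (ext (λ ()) y (λ ())) ⟩
    ℚ.∣ g y ∣        ≤⟨ at-y ⟩
    M                ≡⟨ solve 1 (λ m → m := con 0ℚ :+ con 1ℚ :* m) refl M ⟩
    0ℚ ℚ.+ 1ℚ ℚ.* M  ≤⟨ ℚ.+-monoˡ-≤ (1ℚ ℚ.* M) 0≤B ⟩
    B ℚ.+ 1ℚ ℚ.* M   ∎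
    where open ℚ.≤-Reasoning
  ∣E∣≤-corner {suc n} y T g B M ext 0≤B le at-y with T zero in eq
  ... | false = subst (λ s → ℚ.∣ E (y ∘ suc) (T ∘ suc) θ (λ x → g (y zero ◂ x)) ∣ ℚ.≤ B ℚ.+ s ℚ.* M) (sym (ℚ.*-identityˡ (stay (T ∘ suc) θ)))
    (∣E∣≤-corner (y ∘ suc) (T ∘ suc) (λ x → g (y zero ◂ x)) B M (λ x x' x≡x' → ext _ _ (◂-cong x≡x')) 0≤B
      (λ x x∈ x≢y → le (y zero ◂ x) (λ { zero _ → refl ; (suc i) → x∈ i }) (λ x≡y → x≢y (x≡y ∘ suc)))
      (subst (λ v → ℚ.∣ v ∣ ℚ.≤ M) (sym (ext _ _ (◂-η y))) at-y))
  ... | true = ℚ.≤-trans (∣mix∣≤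
      (∣E∣≤-corner (y ∘ suc) (T ∘ suc) (λ x → g (y zero ◂ x)) B M (λ x x' x≡x' → ext _ _ (◂-cong x≡x')) 0≤B
        (λ x x∈ x≢y → le (y zero ◂ x) (λ { zero _ → refl ; (suc i) → x∈ i }) (λ x≡y → x≢y (x≡y ∘ suc)))
        (subst (λ v → ℚ.∣ v ∣ ℚ.≤ M) (sym (ext _ _ (◂-η y))) at-y))
      -- After a flip in the first coordinate the corner is out of reach, so `B` bounds this whole
      -- face.
      (∣E∣≤ (y ∘ suc) (T ∘ suc) (λ x → g (not (y zero) ◂ x)) B
        (λ x x∈ → le (not (y zero) ◂ x) (λ { zero T0≡false → ⊥-elim (true≢false (trans (sym eq) T0≡false)) ; (suc i) → x∈ i })
          (λ x≡y → not≢ (x≡y zero)))))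
    (ℚ.≤-reflexive (solve 4 (λ t b s m → (con 1ℚ :- t) :* (b :+ s :* m) :+ t :* b := b :+ ((con 1ℚ :- t) :* s) :* m) refl θ B (stay (T ∘ suc) θ) M))

⅓ : ℚ
⅓ = (ℤ.+ 1) ℚ./ 3

-- If the dimension w exceeded 105 D², every θ = node / w would lie in [0,1]. As wθ ≥ 5, the corner
-- would be kept with probability at most 1/6, so |F(θ)| ≤ (1/3 + 1/6) |F(0)| at all nodes, against
-- `no-jump`. Degree 0 is treated separately.
corner-degree : ∀ {n} (y T : Input n) (c : Poly n) D → DegLe c D →
                (∀ x → InCube y T x → ¬ (∀ i → x i ≡ y i) → ℚ.∣ eval c x ∣ ℚ.≤ ⅓) → 1ℚ ℚ.≤ ℚ.∣ eval c y ∣ →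
                weight T ≤ 105 * (D * D)
corner-degree {n} y T c D deg low high = bound D (E-eval-deg y T c D deg)
  where
  open ℚ.≤-Reasoning
  F : ℚ → ℚ
  F θ = E y T θ (eval c)
  M : ℚ
  M = ℚ.∣ F 0ℚ ∣
  F0≡ : F 0ℚ ≡ eval c y
  F0≡ = E-0 y T (eval c) (eval-ext c)
  1≤M : 1ℚ ℚ.≤ M
  1≤M = subst (λ v → 1ℚ ℚ.≤ ℚ.∣ v ∣) (sym F0≡) high
  0<M : 0ℚ ℚ.< M
  0<M = ℚ.<-≤-trans (ℚ.positive⁻¹ 1ℚ) 1≤M
  0≤M : 0ℚ ℚ.≤ M
  0≤M = ℚ.<⇒≤ 0<M
  F-small : ∀ θ j → 0ℚ ℚ.≤ θ → θ ℚ.≤ 1ℚ → ι (suc j) ℚ.≤ 1ℚ ℚ.+ ι (weight T) ℚ.* θ → ℚ.∣ F θ ∣ ℚ.≤ (⅓ ℚ.+ recip j) ℚ.* M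
  F-small θ j 0≤θ θ≤1 le = begin
    ℚ.∣ F θ ∣                    ≤⟨ ∣E∣≤-corner θ 0≤θ θ≤1 y T (eval c) ⅓ M (eval-ext c) (ℚ.nonNegative⁻¹ ⅓) low (ℚ.≤-reflexive (cong ℚ.∣_∣ (sym F0≡))) ⟩
    ⅓ ℚ.+ s ℚ.* M                ≤⟨ ℚ.+-mono-≤ (subst (ℚ._≤ ⅓ ℚ.* M) (ℚ.*-identityʳ ⅓) (*-monoˡ (ℚ.nonNegative⁻¹ ⅓) 1≤M)) (*-monoʳ 0≤M s≤) ⟩
    ⅓ ℚ.* M ℚ.+ recip j ℚ.* M    ≡⟨ ℚ.*-distribʳ-+ M ⅓ (recip j) ⟨
    (⅓ ℚ.+ recip j) ℚ.* M        ∎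
    where
    s : ℚ
    s = stay T θ
    s≤ : s ℚ.≤ recip j
    s≤ = begin
      s                                              ≡⟨ ℚ.*-identityʳ s ⟨
      s ℚ.* 1ℚ                                       ≡⟨ cong (s ℚ.*_) (ι*recip j) ⟨
      s ℚ.* (ι (suc j) ℚ.* recip j)                  ≡⟨ ℚ.*-assoc s (ι (suc j)) (recip j) ⟨
      (s ℚ.* ι (suc j)) ℚ.* recip j                  ≤⟨ *-monoʳ (recip-nonNeg j) (*-monoˡ (stay-nonNeg θ 0≤θ θ≤1 T) le) ⟩
      (s ℚ.* (1ℚ ℚ.+ ι (weight T) ℚ.* θ)) ℚ.* recip j ≤⟨ *-monoʳ (recip-nonNeg j) (bernoulli θ 0≤θ θ≤1 T) ⟩
      1ℚ ℚ.* recip j                                 ≡⟨ ℚ.*-identityˡ (recip j) ⟩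
      recip j                                        ∎
  bound : ∀ D → PolyDeg≤ D F → weight T ≤ 105 * (D * D)
  bound zero (a , F≡a) with weight T in eq
  ... | zero  = z≤n
  -- A constant `F` is compared at θ = 0 and θ = 1: the value at 1 is at most (1/3 + 1/2) M, less
  -- than M.
  ... | suc w = ⊥-elim (ℚ.<-irrefl refl (begin-strict
    M                          ≡⟨ cong ℚ.∣_∣ (trans (F≡a 0ℚ) (sym (F≡a 1ℚ))) ⟩
    ℚ.∣ F 1ℚ ∣                 ≤⟨ F-small 1ℚ 1 0≤1 ℚ.≤-refl (subst (λ w → ι 2 ℚ.≤ 1ℚ ℚ.+ ι w ℚ.* 1ℚ) (sym eq)
                                    (ℚ.≤-trans (ι-mono {2} {suc (suc w)} (s≤s (s≤s z≤n))) (ℚ.≤-reflexive (cong (1ℚ ℚ.+_) (sym (ℚ.*-identityʳ (ι (suc w)))))))) ⟩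
    (⅓ ℚ.+ recip 1) ℚ.* M      <⟨ ℚ.*-monoˡ-<-pos M {{ℚ.positive 0<M}} (toWitness {a? = (⅓ ℚ.+ recip 1) ℚ.<? 1ℚ} tt) ⟩
    1ℚ ℚ.* M                   ≡⟨ ℚ.*-identityˡ M ⟩
    M ∎))
  bound (suc d) F-deg with weight T ℕ.≤? 105 * (suc d * suc d)
  ... | yes w≤ = w≤
  ... | no w≰  = ⊥-elim (no-jump d F σ F-deg 0<M small)
    where
    N = suc d
    w = pred (weight T)
    large : 105 * (N * N) < weight T
    large = ℕ.≰⇒> w≰
    w≡ : suc w ≡ weight T
    w≡ = ℕ.suc-pred (weight T) {{>-nonZero (ℕ.≤-<-trans z≤n large)}}
    σ : ℚ
    σ = recip w
    wσ≡1 : ι (weight T) ℚ.* σ ≡ 1ℚ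
    wσ≡1 = subst (λ v → ι v ℚ.* σ ≡ 1ℚ) w≡ (ι*recip w)
    dist≤ : ∀ i → i ≤ N + N → ∣ i - N ∣ ≤ N
    dist≤ i i≤2N with ℕ.≤-total i N
    ... | inj₁ i≤N = ℕ.≤-trans (ℕ.≤-reflexive (ℕ.m≤n⇒∣m-n∣≡n∸m i≤N)) (ℕ.m∸n≤m N i)
    ... | inj₂ N≤i = ℕ.≤-trans (ℕ.≤-reflexive (ℕ.m≤n⇒∣n-m∣≡n∸m N≤i)) (ℕ.≤-trans (ℕ.∸-monoˡ-≤ N i≤2N) (ℕ.≤-reflexive (ℕ.m+n∸n≡m N N)))
    -- As N is positive, 5 ≤ 5 N², whence 100 N² + 5 ≤ 105 N².
    node≤ : ∀ i → i ≤ N + N → node N i ≤ weight T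
    node≤ i i≤2N = ℕ.≤-trans (ℕ.+-mono-≤ (ℕ.*-monoʳ-≤ 100 (ℕ.*-mono-≤ (dist≤ i i≤2N) (dist≤ i i≤2N))) (ℕ.*-monoʳ-≤ 5 (s≤s (z≤n {d + d * N}))))
      (ℕ.≤-trans (ℕ.≤-reflexive (sym (ℕ.*-distribʳ-+ (N * N) 100 5))) (ℕ.<⇒≤ large))
    small : ∀ i → i ≤ N + N → ℚ.∣ F (ι (node N i) ℚ.* σ) ∣ ℚ.≤ ½ ℚ.* M
    -- The index 5 stands for 1/6, and 1/3 + 1/6 = 1/2.
    small i i≤2N = F-small θ 5
      (0≤* (ι-nonNeg (node N i)) (recip-nonNeg w))
      (subst (θ ℚ.≤_) wσ≡1 (*-monoʳ (recip-nonNeg w) (ι-mono (node≤ i i≤2N))))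
      (ℚ.≤-trans (ι-mono {6} {suc (node N i)} (s≤s (ℕ.m≤n+m 5 (100 * (∣ i - N ∣ * ∣ i - N ∣))))) (ℚ.≤-reflexive (cong (1ℚ ℚ.+_) (sym wθ≡))))
      where
      θ : ℚ
      θ = ι (node N i) ℚ.* σ
      wθ≡ : ι (weight T) ℚ.* θ ≡ ι (node N i)
      wθ≡ = trans (solve 3 (λ w n s → w :* (n :* s) := n :* (w :* s)) refl (ι (weight T)) (ι (node N i)) σ)
              (trans (cong (ι (node N i) ℚ.*_) wσ≡1) (ℚ.*-identityʳ (ι (node N i))))

-- Alternating chains

bit : Bool → ℕ
bit b = if b then 1 else 0

weight-+ : ∀ {n} (A B C : Input n) → (∀ i → bit (C i) ≡ bit (A i) + bit (B i)) → weight C ≡ weight A + weight B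
weight-+ {zero}  A B C eq = refl
weight-+ {suc n} A B C eq = trans
  (cong₂ _+_ (eq zero) (weight-+ (A ∘ suc) (B ∘ suc) (C ∘ suc) (eq ∘ suc)))
  (interchange ℕ.+-commutativeSemigroup (bit (A zero)) (bit (B zero)) (weight (A ∘ suc)) (weight (B ∘ suc)))

weight-pos : ∀ {n} (A : Input n) t → A t ≡ true → 1 ≤ weight A
weight-pos {suc n} A zero    eq rewrite eq = s≤s z≤n
weight-pos {suc n} A (suc t) eq = ℕ.≤-trans (weight-pos (A ∘ suc) t eq) (ℕ.m≤n+m (weight (A ∘ suc)) (bit (A zero)))

weight≡0 : ∀ {n} (A : Input n) → weight A ≡ 0 → ∀ i → A i ≡ false
weight≡0 A eq i with A i in Ai
... | false = refl
... | true  = ⊥-elim (ℕ.<-irrefl (sym eq) (weight-pos A i Ai))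

diff : ∀ {n} → Input n → Input n → Input n
diff x y i = x i xor y i

dist : ∀ {n} → Input n → Input n → ℕ
dist x y = weight (diff x y)

xor≡false : ∀ {a b} → a xor b ≡ false → a ≡ b
xor≡false {true}  {true}  _ = refl
xor≡false {false} {false} _ = refl

xor-self : ∀ a → a xor a ≡ false
xor-self true  = refl
xor-self false = refl

_≗?_ : ∀ {n} (x y : Input n) → Dec (∀ i → x i ≡ y i)
x ≗? y = Fin.all? (λ i → x i Bool.≟ y i)

dist≡0 : ∀ {n} (x y : Input n) → dist x y ≡ 0 → ∀ i → x i ≡ y i
dist≡0 x y eq i = xor≡false (weight≡0 (diff x y) eq i)

-- The search visits only inputs built by `◂`, one for each pointwise class, so `P` has to respect
-- pointwise equality.
anyInput : ∀ n {P : Input n → Set} → (∀ x x' → (∀ i → x i ≡ x' i) → P x → P x') → (∀ x → Dec (P x)) → Dec (Σ (Input n) P)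
anyInput zero    resp P? = map′ (λ p → allFalse , p) (λ (x , p) → resp x allFalse (λ ()) p) (P? allFalse)
anyInput (suc n) {P} resp P?
  with anyInput n {λ x → P (true ◂ x)} (λ x x' eq → resp _ _ (◂-cong eq)) (λ x → P? (true ◂ x))
     | anyInput n {λ x → P (false ◂ x)} (λ x x' eq → resp _ _ (◂-cong eq)) (λ x → P? (false ◂ x))
... | yes (x , p) | _           = yes (true ◂ x , p)
... | no _        | yes (x , p) = yes (false ◂ x , p)
... | no ¬t       | no ¬f       = no none
  where
  none : ¬ Σ (Input (suc n)) P
  none (x , p) with x zero in eq
  ... | true  = ¬t (x ∘ suc , resp x _ (λ { zero → eq ; (suc i) → refl }) p)
  ... | false = ¬f (x ∘ suc , resp x _ (λ { zero → eq ; (suc i) → refl }) p)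

-- x ⊑[ s ] y: y arises from x by changing bits from not s to s; s = true is the usual order.
_⊑[_]_ : ∀ {n} → Input n → Bool → Input n → Set
x ⊑[ s ] y = ∀ i → x i ≡ s → y i ≡ s

⊑-refl : ∀ {n s} {x : Input n} → x ⊑[ s ] x
⊑-refl i eq = eq

⊑-trans : ∀ {n s} {x y z : Input n} → x ⊑[ s ] y → y ⊑[ s ] z → x ⊑[ s ] z
⊑-trans p q i eq = q i (p i eq)

⊑-reflexive : ∀ {n s} {x y : Input n} → (∀ i → x i ≡ y i) → x ⊑[ s ] y
⊑-reflexive x≡y i eq = trans (sym (x≡y i)) eq

⊑-flip : ∀ {n s} {x y : Input n} → x ⊑[ s ] y → y ⊑[ not s ] x
⊑-flip {s = s} {x} {y} p i yi with x i Bool.≟ s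
... | yes xi = ⊥-elim (not≢ (trans (sym yi) (p i xi)))
... | no xi  = ≢⇒≡not xi

⊑-unflip : ∀ {n s} {x y : Input n} → y ⊑[ not s ] x → x ⊑[ s ] y
⊑-unflip {s = s} p = subst (λ s → _ ⊑[ s ] _) (Bool.not-involutive s) (⊑-flip p)

_⊑[_]?_ : ∀ {n} (x : Input n) s (y : Input n) → Dec (x ⊑[ s ] y)
x ⊑[ s ]? y = Fin.all? (λ i → (x i Bool.≟ s) →-dec (y i Bool.≟ s))

-- Along a monotone sequence no coordinate changes twice.
dist-+ : ∀ {n} s {x y z : Input n} → x ⊑[ s ] y → y ⊑[ s ] z → dist x z ≡ dist x y + dist y z
dist-+ s {x} {y} {z} p q = weight-+ (diff x y) (diff y z) (diff x z) (λ i → go s (x i) (y i) (z i) (p i) (q i))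
  where
  go : ∀ s a b c → (a ≡ s → b ≡ s) → (b ≡ s → c ≡ s) → bit (a xor c) ≡ bit (a xor b) + bit (b xor c)
  go true  true  b c p q rewrite p refl | q refl = refl
  go true  false true c p q rewrite q refl = refl
  go true  false false c p q = refl
  go false false b c p q rewrite p refl | q refl = refl
  go false true  false c p q rewrite q refl = refl
  go false true  true true  p q = refl
  go false true  true false p q = refl

dist-pos : ∀ {n} {x y : Input n} → ¬ (∀ i → x i ≡ y i) → 1 ≤ dist x y
dist-pos {x = x} {y} x≢y with dist x y in eq
... | zero  = ⊥-elim (x≢y (dist≡0 x y eq))
... | suc _ = s≤s z≤n

cube-interval : ∀ {n} s {x y u : Input n} → x ⊑[ s ] y → InCube y (diff x y) u → x ⊑[ s ] u × u ⊑[ s ] y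
cube-interval {n} s {x} {y} {u} x⊑y u∈ = below , above
  where
  below : x ⊑[ s ] u
  below i xi = trans (u∈ i (trans (cong₂ _xor_ xi (x⊑y i xi)) (xor-self s))) (x⊑y i xi)
  above : u ⊑[ s ] y
  above i ui with x i xor y i in eq
  ... | false = trans (sym (u∈ i eq)) ui
  ... | true with x i Bool.≟ s
  ...   | yes xi = x⊑y i xi
  ...   | no xi  with y i Bool.≟ s
  ...     | yes yi = yi
  ...     | no yi  = ⊥-elim (true≢false (trans (sym eq) (trans (cong₂ _xor_ (≢⇒≡not xi) (≢⇒≡not yi)) (xor-self (not s)))))

module Alternation {n : ℕ} (f : BoolFun n) (f-ext : Extensional f) where

  -- Only the turning points of a monotone path are recorded: flat compares f at its two end points and ignores the
  -- values in between, so m is a lower bound for the alternations of any path through these points.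
  data Chain (s : Bool) (x y : Input n) : ℕ → Set where
    flat : x ⊑[ s ] y → f x ≡ f y → Chain s x y 0
    turn : ∀ {w m} → x ⊑[ s ] w → f x ≢ f w → Chain s w y m → Chain s x y (suc m)

  Chain-⊑ : ∀ {s x y m} → Chain s x y m → x ⊑[ s ] y
  Chain-⊑ (flat p _)   = p
  Chain-⊑ (turn p _ c) = ⊑-trans p (Chain-⊑ c)

  Chain-extend : ∀ {s x y z m} → x ⊑[ s ] y → f x ≡ f y → Chain s y z m → Chain s x z m
  Chain-extend p eq (flat q eq')   = flat (⊑-trans p q) (trans eq eq')
  Chain-extend p eq (turn q neq c) = turn (⊑-trans p q) (λ e → neq (trans (sym eq) e)) c

  _++ᶜ_ : ∀ {s x y z m k} → Chain s x y m → Chain s y z k → Chain s x z (m + k)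
  flat p eq    ++ᶜ d = Chain-extend p eq d
  turn p neq c ++ᶜ d = turn p neq (c ++ᶜ d)

  Chain-reverse : ∀ {s x y m} → Chain s x y m → Chain (not s) y x m
  Chain-reverse (flat p eq) = flat (⊑-flip p) (sym eq)
  Chain-reverse {s} {m = suc m} (turn {w} p neq c) = subst (Chain (not s) _ _) (ℕ.+-comm m 1)
    (Chain-reverse c ++ᶜ turn (⊑-flip p) (neq ∘ sym) (flat ⊑-refl refl))

  Chain-exists : ∀ {s x y} → x ⊑[ s ] y → Σ ℕ (Chain s x y)
  Chain-exists {s} {x} {y} p with f x Bool.≟ f y
  ... | yes eq = 0 , flat p eq
  ... | no neq = 1 , turn p neq (flat ⊑-refl refl)

  -- While another point of the interval still has the changed value, `v` is replaced by it; the
  -- distance from `z` drops each time. At the end `y` is the one exceptional corner of its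
  -- interval, the situation that `gap` measures.
  minimal-change : ∀ s fuel z v → dist z v ≤ fuel → z ⊑[ s ] v → f v ≢ f z →
    Σ (Input n) λ y → z ⊑[ s ] y × y ⊑[ s ] v × f y ≢ f z ×
      (∀ u → z ⊑[ s ] u → u ⊑[ s ] y → ¬ (∀ i → u i ≡ y i) → f u ≡ f z)
  minimal-change s fuel z v le z⊑v fv≢fz
    with anyInput n {λ u → z ⊑[ s ] u × u ⊑[ s ] v × ¬ (∀ i → u i ≡ v i) × f u ≢ f z}
           (λ x x' eq (p , q , r , t) → ⊑-trans p (⊑-reflexive eq) , ⊑-trans (⊑-reflexive (sym ∘ eq)) q ,
             (λ e → r (λ i → trans (eq i) (e i))) , (λ e → t (trans (f-ext x x' eq) e)))
           (λ u → (z ⊑[ s ]? u) ×-dec (u ⊑[ s ]? v) ×-dec ¬? (u ≗? v) ×-dec ¬? (f u Bool.≟ f z))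
  ... | no none = v , z⊑v , ⊑-refl , fv≢fz , λ u z⊑u u⊑v u≢v → only u z⊑u u⊑v u≢v
    where
    only : ∀ u → z ⊑[ s ] u → u ⊑[ s ] v → ¬ (∀ i → u i ≡ v i) → f u ≡ f z
    only u z⊑u u⊑v u≢v with f u Bool.≟ f z
    ... | yes eq = eq
    ... | no neq = ⊥-elim (none (u , z⊑u , u⊑v , u≢v , neq))
  ... | yes (u , z⊑u , u⊑v , u≢v , fu≢fz) with fuel
  ...   | zero = ⊥-elim (ℕ.<⇒≱ (ℕ.≤-trans (dist-pos u≢v) (ℕ.≤-trans (ℕ.m≤n+m _ (dist z u)) (ℕ.≤-reflexive (sym (dist-+ s z⊑u u⊑v))))) le)
  ...   | suc fuel' =
    let (y , z⊑y , y⊑u , fy , rest) = minimal-change s fuel' z u smaller z⊑u fu≢fz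
    in y , z⊑y , ⊑-trans y⊑u u⊑v , fy , rest
    where
    smaller : dist z u ≤ fuel'
    smaller = s≤s⁻¹ (ℕ.≤-trans (ℕ.≤-reflexive (ℕ.+-comm 1 (dist z u))) (ℕ.≤-trans (ℕ.+-monoʳ-≤ (dist z u) (dist-pos u≢v))
      (ℕ.≤-trans (ℕ.≤-reflexive (sym (dist-+ s z⊑u u⊑v))) le)))

  module Gaps (c : ℕ)
    (gap : ∀ z y → f z ≢ f y → (∀ u → InCube y (diff z y) u → ¬ (∀ i → u i ≡ y i) → f u ≡ f z) → dist z y ≤ c)
    where

    -- Jump repeatedly to a minimal point where f changes until f is constant up to `w`. By `gap`
    -- each jump has length at most `c` and yields one alternation.
    greedy : ∀ s fuel z w → dist z w ≤ fuel → z ⊑[ s ] w →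
      Σ (Input n) λ y → Σ ℕ λ g → y ⊑[ s ] w × Chain s z y g × dist z y ≤ g * c ×
        (∀ v → y ⊑[ s ] v → v ⊑[ s ] w → f v ≡ f y)
    greedy s fuel z w le z⊑w
      with anyInput n {λ v → z ⊑[ s ] v × v ⊑[ s ] w × f v ≢ f z}
             (λ x x' eq (p , q , t) → ⊑-trans p (⊑-reflexive eq) , ⊑-trans (⊑-reflexive (sym ∘ eq)) q ,
               (λ e → t (trans (f-ext x x' eq) e)))
             (λ v → (z ⊑[ s ]? v) ×-dec (v ⊑[ s ]? w) ×-dec ¬? (f v Bool.≟ f z))
    ... | no none = z , 0 , z⊑w , flat ⊑-refl refl , ℕ.≤-reflexive dist-self , only
      where
      dist-self : dist z z ≡ 0
      dist-self = ℕ.+-cancelˡ-≡ (dist z z) (dist z z) 0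
        (trans (sym (dist-+ s (⊑-refl {x = z}) (⊑-refl {x = z}))) (sym (ℕ.+-identityʳ (dist z z))))
      only : ∀ v → z ⊑[ s ] v → v ⊑[ s ] w → f v ≡ f z
      only v z⊑v v⊑w with f v Bool.≟ f z
      ... | yes eq = eq
      ... | no neq = ⊥-elim (none (v , z⊑v , v⊑w , neq))
    ... | yes (v , z⊑v , v⊑w , fv≢fz) with minimal-change s (dist z v) z v ℕ.≤-refl z⊑v fv≢fz
    ...   | y , z⊑y , y⊑v , fy≢fz , rest with fuel
    ...     | zero = ⊥-elim (ℕ.<⇒≱ (ℕ.≤-trans (dist-pos z≢y) (ℕ.≤-trans (ℕ.m≤m+n _ (dist y w)) (ℕ.≤-reflexive (sym (dist-+ s z⊑y (⊑-trans y⊑v v⊑w)))))) le)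
      where
      z≢y : ¬ (∀ i → z i ≡ y i)
      z≢y eq = fy≢fz (sym (f-ext z y eq))
    ...     | suc fuel' =
      let (y' , g , y'⊑w , chain , d , const) = greedy s fuel' y w smaller y⊑w
      in y' , suc g , y'⊑w , turn z⊑y (fy≢fz ∘ sym) chain ,
         ℕ.≤-trans (ℕ.≤-reflexive (dist-+ s z⊑y (Chain-⊑ chain))) (ℕ.+-mono-≤ first d) , const
      where
      y⊑w : y ⊑[ s ] w
      y⊑w = ⊑-trans y⊑v v⊑w
      z≢y : ¬ (∀ i → z i ≡ y i)
      z≢y eq = fy≢fz (sym (f-ext z y eq))
      smaller : dist y w ≤ fuel'
      smaller = s≤s⁻¹ (ℕ.≤-trans (ℕ.+-monoˡ-≤ (dist y w) (dist-pos z≢y)) (ℕ.≤-trans (ℕ.≤-reflexive (sym (dist-+ s z⊑y y⊑w))) le))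
      first : dist z y ≤ c
      first = gap z y (fy≢fz ∘ sym) (λ u u∈ u≢y → let (z⊑u , u⊑y) = cube-interval s z⊑y u∈ in rest u z⊑u u⊑y u≢y)

-- Disjoint sensitive blocks

count : ∀ {A : Set} → (A → Bool) → List A → ℕ
count p xs = sum (map (bit ∘ p) xs)

reject : ∀ {A : Set} → (A → Bool) → List A → List A
reject p = filter (λ x → p x Bool.≟ false)

length-reject : ∀ {A : Set} (p : A → Bool) xs → length xs ≡ count p xs + length (reject p xs)
length-reject p []       = refl
length-reject p (x ∷ xs) with p x
... | true  = cong suc (length-reject p xs)
... | false = trans (cong suc (length-reject p xs)) (sym (ℕ.+-suc (count p xs) (length (reject p xs))))

sum-map-+ : ∀ {A : Set} (g h : A → ℕ) xs → sum (map (λ x → g x + h x) xs) ≡ sum (map g xs) + sum (map h xs)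
sum-map-+ g h []       = refl
sum-map-+ g h (x ∷ xs) = trans (cong (g x + h x +_) (sum-map-+ g h xs)) (interchange ℕ.+-commutativeSemigroup (g x) (h x) (sum (map g xs)) (sum (map h xs)))

sum-map-zero : ∀ {A : Set} (xs : List A) → sum (map (λ _ → 0) xs) ≡ 0
sum-map-zero []       = refl
sum-map-zero (x ∷ xs) = sum-map-zero xs

sum-swap : ∀ {A B : Set} (M : A → B → ℕ) xs ys →
           sum (map (λ x → sum (map (M x) ys)) xs) ≡ sum (map (λ y → sum (map (λ x → M x y) xs)) ys)
sum-swap M []       ys = sym (sum-map-zero ys)
sum-swap M (x ∷ xs) ys = trans (cong (sum (map (M x) ys) +_) (sum-swap M xs ys))
  (sym (sum-map-+ (M x) (λ y → sum (map (λ x → M x y) xs)) ys))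

pigeonhole : ∀ {A : Set} (g h : A → ℕ) x xs → sum (map g (x ∷ xs)) ≤ sum (map h (x ∷ xs)) → Σ A λ y → y ∈ x ∷ xs × g y ≤ h y
pigeonhole g h x xs le with g x ℕ.≤? h x
... | yes gx≤hx = x , here refl , gx≤hx
pigeonhole g h x []       le | no gx≰hx =
  ⊥-elim (gx≰hx (subst₂ _≤_ (ℕ.+-identityʳ (g x)) (ℕ.+-identityʳ (h x)) le))
pigeonhole g h x (y ∷ ys) le | no gx≰hx =
  let (z , z∈ , gz≤hz) = pigeonhole g h y ys rest in z , there z∈ , gz≤hz
  where
  rest : sum (map g (y ∷ ys)) ≤ sum (map h (y ∷ ys))
  rest = ℕ.+-cancelˡ-≤ (h x) _ _ (ℕ.≤-trans (ℕ.+-monoˡ-≤ _ (ℕ.<⇒≤ (ℕ.≰⇒> gx≰hx))) le)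

Disjoint : ∀ {n} → Input n → Input n → Set
Disjoint A B = ∀ t → A t ∧ B t ≡ false

Disjoint-sym : ∀ {n} (A B : Input n) → Disjoint A B → Disjoint B A
Disjoint-sym A B d t = trans (Bool.∧-comm (B t) (A t)) (d t)

Disjoint-off : ∀ {n} (A B : Input n) → Disjoint A B → ∀ t → A t ≡ true → B t ≡ false
Disjoint-off A B d t At = trans (sym (cong (_∧ B t) At)) (d t)

disjoint-or-equal : ∀ {n} {Bs : List (Input n)} {A B} → AllPairs Disjoint Bs → A ∈ Bs → B ∈ Bs → A ≡ B ⊎ Disjoint A B
disjoint-or-equal (_  ∷ _)  (here refl) (here refl) = inj₁ refl
disjoint-or-equal (ds ∷ _)  (here refl) (there B∈)  = inj₂ (All.lookup ds B∈)
disjoint-or-equal {A = A} {B} (ds ∷ _) (there A∈) (here refl) = inj₂ (Disjoint-sym B A (All.lookup ds A∈))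
disjoint-or-equal (_  ∷ ps) (there A∈)  (there B∈)  = disjoint-or-equal ps A∈ B∈

Touches : ∀ {n} → Input n → Input n → Set
Touches T B = Σ _ λ t → B t ≡ true × T t ≡ true

touches? : ∀ {n} (T B : Input n) → Dec (Touches T B)
touches? T B = Fin.any? (λ t → (B t Bool.≟ true) ×-dec (T t Bool.≟ true))

-- Disjoint blocks meet `T` in different coordinates. The induction makes this explicit by removing
-- each counted block from `T`.
count-touching : ∀ {n} (p : Input n → Bool) T Bs → AllPairs Disjoint Bs →
                 (∀ {B} → B ∈ Bs → p B ≡ true → Touches T B) → count p Bs ≤ weight T
count-touching p T []       []       touch = z≤n
count-touching p T (B ∷ Bs) (d ∷ ds) touch with p B in eq
... | false = count-touching p T Bs ds (touch ∘ there)
... | true  = begin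
  suc (count p Bs)                              ≤⟨ s≤s (count-touching p T∖B Bs ds touch′) ⟩
  suc (weight T∖B)                              ≡⟨ ℕ.+-comm 1 (weight T∖B) ⟩
  weight T∖B + 1                                ≤⟨ ℕ.+-monoʳ-≤ (weight T∖B) (weight-pos T∩B t (cong₂ _∧_ Tt Bt)) ⟩
  weight T∖B + weight T∩B                       ≡⟨ weight-+ T∖B T∩B T (λ i → split (T i) (B i)) ⟨
  weight T                                      ∎
  where
  open ℕ.≤-Reasoning
  T∖B T∩B : Input _
  T∖B i = T i ∧ not (B i)
  T∩B i = T i ∧ B i
  t = proj₁ (touch (here refl) eq)
  Bt = proj₁ (proj₂ (touch (here refl) eq))
  Tt = proj₂ (proj₂ (touch (here refl) eq))
  split : ∀ a b → bit a ≡ bit (a ∧ not b) + bit (a ∧ b)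
  split true  true  = refl
  split true  false = refl
  split false b     = refl
  touch′ : ∀ {A} → A ∈ Bs → p A ≡ true → Touches T∖B A
  touch′ {A} A∈ pA = let (u , Au , Tu) = touch (there A∈) pA
    in u , Au , cong₂ _∧_ Tu (cong not (Disjoint-off A B (Disjoint-sym B A (All.lookup d A∈)) u Au))

setBits : ∀ {n} → Bool → Input n → Input n → Input n
setBits s w B t = if B t then s else w t

xor≡true : ∀ {a} b → b ≢ a → b xor a ≡ true
xor≡true {true}  true  b≢a = ⊥-elim (b≢a refl)
xor≡true {false} true  b≢a = refl
xor≡true {true}  false b≢a = refl
xor≡true {false} false b≢a = ⊥-elim (b≢a refl)

-- Moving the base point and counting the lost blocks.

module Blocks {n : ℕ} (f : BoolFun n) (f-ext : Extensional f) (c : ℕ)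
  (gap : ∀ z y → f z ≢ f y → (∀ u → InCube y (diff z y) u → ¬ (∀ i → u i ≡ y i) → f u ≡ f z) → dist z y ≤ c)
  where

  open Alternation f f-ext
  open Gaps c gap

  -- The state of the induction: f is constant on both sides of `x` within the interval, `k` bounds
  -- the alternations still available, and the blocks lie in the coordinates where `lo` and `hi`
  -- differ, so changing a block stays within the interval.
  record Config (s : Bool) (lo x hi : Input n) (k : ℕ) (Bs : List (Input n)) : Set where
    field
      lo⊑x      : lo ⊑[ s ] x
      x⊑hi      : x ⊑[ s ] hi
      below     : ∀ v → lo ⊑[ s ] v → v ⊑[ s ] x → f v ≡ f x
      above     : ∀ v → x ⊑[ s ] v → v ⊑[ s ] hi → f v ≡ f x
      short     : ∀ {m} → Chain s lo hi m → m ≤ k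
      disjoint  : AllPairs Disjoint Bs
      free      : ∀ {B} → B ∈ Bs → ∀ t → B t ≡ true → lo t ≡ not s × hi t ≡ s
      sensitive : ∀ {B} → B ∈ Bs → f (flipB x B) ≢ f x

  -- Reversing the order exchanges `lo` and `hi`, so that `advance` has to treat only moves towards
  -- `hi`.
  Config-flip : ∀ {s lo x hi k Bs} → Config s lo x hi k Bs → Config (not s) hi x lo k Bs
  Config-flip {s} {lo} {x} {hi} cfg = record
    { lo⊑x      = ⊑-flip x⊑hi
    ; x⊑hi      = ⊑-flip lo⊑x
    ; below     = λ v p q → above v (⊑-unflip q) (⊑-unflip p)
    ; above     = λ v p q → below v (⊑-unflip q) (⊑-unflip p)
    ; short     = λ ch → short (subst (λ s → Chain s lo hi _) (Bool.not-involutive s) (Chain-reverse ch))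
    ; disjoint  = disjoint
    ; free      = λ B∈ t Bt → trans (proj₂ (free B∈ t Bt)) (sym (Bool.not-involutive s)) , proj₁ (free B∈ t Bt)
    ; sensitive = sensitive
    }
    where open Config cfg

  interferes : Input n → Bool → Input n → Input n → Bool
  interferes x s i l = f (setBits s (flipB x i) l) xor f (flipB x i)

  -- `col` counts the blocks endangered by setting block `l` to `s`. `row` counts the blocks
  -- one-sidedly sensitive at x^l in the opposite direction, a number that alternations control.
  col row : Input n → List (Input n) → Bool → Input n → ℕ
  col x Bs s l = count (λ i → interferes x s i l) Bs
  row x Bs s l = count (interferes x (not s) l) Bs

  -- Summed over all `l` and both directions, columns and rows count the same interfering pairs;
  -- hence some `l` and `s` have column at most row.
  good-direction : ∀ x B Bs → let Bs⁺ = B ∷ Bs in Σ (Input n) λ l → Σ Bool λ s → l ∈ Bs⁺ × col x Bs⁺ s l ≤ row x Bs⁺ s l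
  good-direction x B Bs with pigeonhole (λ l → cols true l + cols false l) (λ l → rows true l + rows false l) B Bs (ℕ.≤-reflexive total)
    where
    Bs⁺ = B ∷ Bs
    cols rows : Bool → Input n → ℕ
    cols = col x Bs⁺
    rows = row x Bs⁺
    swap : ∀ s → sum (map (cols s) Bs⁺) ≡ sum (map (λ l → count (interferes x s l) Bs⁺) Bs⁺)
    swap s = sum-swap (λ l i → bit (interferes x s i l)) Bs⁺ Bs⁺
    total : sum (map (λ l → cols true l + cols false l) Bs⁺) ≡ sum (map (λ l → rows true l + rows false l) Bs⁺)
    total = begin
      sum (map (λ l → cols true l + cols false l) Bs⁺)             ≡⟨ sum-map-+ (cols true) (cols false) Bs⁺ ⟩
      -- `row` uses the opposite direction, so the columns for `true` sum to the rows for `false`.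
      sum (map (cols true) Bs⁺) + sum (map (cols false) Bs⁺)       ≡⟨ cong₂ _+_ (swap true) (swap false) ⟩
      sum (map (rows false) Bs⁺) + sum (map (rows true) Bs⁺)       ≡⟨ ℕ.+-comm (sum (map (rows false) Bs⁺)) _ ⟩
      sum (map (rows true) Bs⁺) + sum (map (rows false) Bs⁺)       ≡⟨ sum-map-+ (rows true) (rows false) Bs⁺ ⟨
      sum (map (λ l → rows true l + rows false l) Bs⁺)             ∎
      where open ≡-Reasoning
  ... | l , l∈ , le with col x (B ∷ Bs) true l ℕ.≤? row x (B ∷ Bs) true l
  ...   | yes le′ = l , true , l∈ , le′
  ...   | no ¬le′ = l , false , l∈ , ℕ.+-cancelˡ-≤ (row x (B ∷ Bs) true l) _ _
                      (ℕ.≤-trans (ℕ.+-monoˡ-≤ _ (ℕ.<⇒≤ (ℕ.≰⇒> ¬le′))) le)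

  -- Climb greedily from `lo` to `z` below w = x^l, then on to `z′` below x′, which is `x` with
  -- block `l` set to `s`. The new state is the interval from `z′` to `hi` around x′. Blocks are
  -- lost by interference, at most r c by the row bound, or by touching coordinates changed between
  -- `lo` and `z′`, at most (r + r′) c.
  advance : ∀ {s lo x hi k Bs} → Config s lo x hi k Bs → ∀ l → l ∈ Bs → col x Bs s l ≤ row x Bs s l →
    Σ ℕ λ g → Σ (Input n) λ lo′ → Σ (Input n) λ x′ → Σ (List (Input n)) λ Bs′ →
      1 ≤ g × g ≤ k × Config s lo′ x′ hi (k ∸ g) Bs′ × length Bs ≤ 2 * (g * c) + length Bs′
  advance {s} {lo} {x} {hi} {k} {Bs} cfg l l∈ col≤row
    with greedy s (dist lo (flipB x l)) lo (flipB x l) ℕ.≤-refl lo⊑w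
    where
    open Config cfg
    lo⊑w : lo ⊑[ s ] flipB x l
    lo⊑w i loi with l i in li
    ... | true  = ⊥-elim (not≢ (trans (sym (proj₁ (free l∈ i li))) loi))
    ... | false = trans (Bool.xor-identityʳ (x i)) (lo⊑x i loi)
  ... | z , r , z⊑w , chain₁ , d₁ , const₁
    with greedy s (dist z (setBits s x l)) z (setBits s x l) ℕ.≤-refl (⊑-trans z⊑w w⊑x′)
    where
    w⊑x′ : flipB x l ⊑[ s ] setBits s x l
    w⊑x′ i wi with l i
    ... | true  = refl
    ... | false = trans (sym (Bool.xor-identityʳ (x i))) wi
  ... | z′ , r′ , z′⊑x′ , chain₂ , d₂ , const₂ =
    r + r′ , z′ , x′ , Bs′ , ℕ.≤-trans 1≤r′ (ℕ.m≤n+m r′ r) , g≤k , config , bound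
    where
    open Config cfg
    w x′ : Input n
    w  = flipB x l
    x′ = setBits s x l
    x⊑x′ : x ⊑[ s ] x′
    x⊑x′ i xi with l i
    ... | true  = refl
    ... | false = xi
    x′⊑hi : x′ ⊑[ s ] hi
    x′⊑hi i x′i with l i in li
    ... | true  = proj₂ (free l∈ i li)
    ... | false = x⊑hi i x′i
    fx′≡fx : f x′ ≡ f x
    fx′≡fx = above x′ x⊑x′ x′⊑hi
    -- f has the value of w at `z` and that of x at `z′`, so sensitivity of `l` forces an
    -- alternation in the second climb.
    fz≢fz′ : f z ≢ f z′
    fz≢fz′ eq = sensitive l∈ (begin
      f w    ≡⟨ const₁ w z⊑w ⊑-refl ⟩
      f z    ≡⟨ eq ⟩
      f z′   ≡⟨ const₂ x′ z′⊑x′ ⊑-refl ⟨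
      f x′   ≡⟨ fx′≡fx ⟩
      f x    ∎)
      where open ≡-Reasoning
    1≤ : ∀ {m} → Chain s z z′ m → 1 ≤ m
    1≤ (flat _ eq)  = ⊥-elim (fz≢fz′ eq)
    1≤ (turn _ _ _) = s≤s z≤n
    1≤r′ : 1 ≤ r′
    1≤r′ = 1≤ chain₂
    chain : Chain s lo z′ (r + r′)
    chain = chain₁ ++ᶜ chain₂
    total : ∀ {m} → Chain s z′ hi m → (r + r′) + m ≤ k
    total ch = short (chain ++ᶜ ch)
    g≤k : r + r′ ≤ k
    g≤k = let (m , ch) = Chain-exists (⊑-trans z′⊑x′ x′⊑hi) in ℕ.≤-trans (ℕ.m≤m+n (r + r′) m) (total ch)
    T : Input n
    T = diff lo z′
    Bs₁ Bs′ : List (Input n)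
    Bs₁ = reject (λ i → interferes x s i l) Bs
    Bs′ = reject (λ B → does (touches? T B)) Bs₁
    disjoint₁ : AllPairs Disjoint Bs₁
    disjoint₁ = AllPairs.filter⁺ (λ i → interferes x s i l Bool.≟ false) disjoint
    weight-T : weight T ≤ (r + r′) * c
    weight-T = begin
      dist lo z′             ≡⟨ dist-+ s (Chain-⊑ chain₁) (Chain-⊑ chain₂) ⟩
      dist lo z + dist z z′  ≤⟨ ℕ.+-mono-≤ d₁ d₂ ⟩
      r * c + r′ * c         ≡⟨ ℕ.*-distribʳ-+ c r r′ ⟨
      (r + r′) * c           ∎
      where open ℕ.≤-Reasoning
    row-touches : ∀ {B} → B ∈ Bs → interferes x (not s) l B ≡ true → Touches (diff lo z) B
    row-touches {B} B∈ changes with touches? (diff lo z) B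
    ... | yes t = t
    ... | no ¬t = ⊥-elim (true≢false (trans (sym changes) (trans (cong (_xor f w) same) (xor-self (f w)))))
      where
      -- If `B` avoids the coordinates changed between `lo` and `z`, then `z` is `not s` on `B`, so
      -- `v` lies between `z` and `w`, where f is constant.
      v : Input n
      v = setBits (not s) w B
      z⊑v : z ⊑[ s ] v
      z⊑v i zi with B i in Bi
      ... | false = z⊑w i zi
      ... | true  with lo i xor z i in eq
      ...   | true  = ⊥-elim (¬t (i , Bi , eq))
      ...   | false = trans (sym (proj₁ (free B∈ i Bi))) (trans (xor≡false eq) zi)
      v⊑w : v ⊑[ s ] w
      v⊑w i vi with B i
      ... | true  = ⊥-elim (not≢ vi)
      ... | false = vi
      same : f v ≡ f w
      same = trans (const₁ v z⊑v v⊑w) (sym (const₁ w z⊑w ⊑-refl))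
    bound : length Bs ≤ 2 * ((r + r′) * c) + length Bs′
    bound = begin
      length Bs                                              ≡⟨ length-reject (λ i → interferes x s i l) Bs ⟩
      col x Bs s l + length Bs₁                              ≡⟨ cong (col x Bs s l +_) (length-reject (λ B → does (touches? T B)) Bs₁) ⟩
      col x Bs s l + (touching + length Bs′)                 ≡⟨ ℕ.+-assoc (col x Bs s l) touching (length Bs′) ⟨
      (col x Bs s l + touching) + length Bs′                 ≤⟨ ℕ.+-monoˡ-≤ (length Bs′) (ℕ.+-mono-≤ col≤ touching≤) ⟩
      ((r + r′) * c + (r + r′) * c) + length Bs′             ≡⟨ cong (λ q → ((r + r′) * c + q) + length Bs′) (ℕ.+-identityʳ ((r + r′) * c)) ⟨
      2 * ((r + r′) * c) + length Bs′                        ∎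
      where
      open ℕ.≤-Reasoning
      touching : ℕ
      touching = count (λ B → does (touches? T B)) Bs₁
      touching≤ : touching ≤ (r + r′) * c
      touching≤ = ℕ.≤-trans (count-touching (λ B → does (touches? T B)) T Bs₁ disjoint₁ (λ {B} _ → witness B)) weight-T
        where
        witness : ∀ B → does (touches? T B) ≡ true → Touches T B
        witness B eq with touches? T B
        ... | yes t = t
      col≤ : col x Bs s l ≤ (r + r′) * c
      col≤ = begin
        col x Bs s l   ≤⟨ col≤row ⟩
        row x Bs s l   ≤⟨ count-touching (interferes x (not s) l) (diff lo z) Bs disjoint row-touches ⟩
        dist lo z      ≤⟨ d₁ ⟩
        r * c          ≤⟨ ℕ.*-monoˡ-≤ c (ℕ.m≤m+n r r′) ⟩
        (r + r′) * c   ∎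
    survives : ∀ {B} → B ∈ Bs′ → B ∈ Bs × interferes x s B l ≡ false × ¬ Touches T B
    survives {B} B∈′ =
      let (B∈₁ , untouched) = ∈-filter⁻ (λ B → does (touches? T B) Bool.≟ false) B∈′
          (B∈ , calm) = ∈-filter⁻ (λ i → interferes x s i l Bool.≟ false) B∈₁
      in B∈ , calm , refute untouched
      where
      refute : does (touches? T B) ≡ false → ¬ Touches T B
      refute eq with touches? T B
      ... | no ¬t = ¬t
    config : Config s z′ x′ hi (k ∸ (r + r′)) Bs′
    config = record
      { lo⊑x      = z′⊑x′
      ; x⊑hi      = x′⊑hi
      ; below     = λ v p q → trans (const₂ v p q) (sym (const₂ x′ z′⊑x′ ⊑-refl))
      ; above     = λ v p q → trans (above v (⊑-trans x⊑x′ p) q) (sym fx′≡fx)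
      ; short     = λ {m} ch → ℕ.m+n≤o⇒m≤o∸n m (subst (_≤ k) (ℕ.+-comm (r + r′) m) (total ch))
      ; disjoint  = AllPairs.filter⁺ (λ B → does (touches? T B) Bool.≟ false) disjoint₁
      ; free      = free′
      ; sensitive = sensitive′
      }
      where
      free′ : ∀ {B} → B ∈ Bs′ → ∀ t → B t ≡ true → z′ t ≡ not s × hi t ≡ s
      free′ {B} B∈′ t Bt with survives B∈′
      ... | B∈ , _ , ¬touch with lo t xor z′ t in eq
      ...   | true  = ⊥-elim (¬touch (t , Bt , eq))
      ...   | false = trans (sym (xor≡false eq)) (proj₁ (free B∈ t Bt)) , proj₂ (free B∈ t Bt)
      sensitive′ : ∀ {B} → B ∈ Bs′ → f (flipB x′ B) ≢ f x′
      sensitive′ {B} B∈′ eq with survives B∈′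
      ... | B∈ , calm , _ with disjoint-or-equal disjoint l∈ B∈
      -- Block `l` interferes with itself: setting it to `s` leads from x^l to x′, where f differs.
      -- Hence it was rejected.
      ...   | inj₁ refl = true≢false (trans (sym (xor≡true (f (setBits s w l)) (λ e → sensitive l∈ (trans (sym e) (trans (f-ext _ _ reset) fx′≡fx))))) calm)
        where
        reset : ∀ t → setBits s w l t ≡ x′ t
        reset t with l t
        ... | true  = refl
        ... | false = Bool.xor-identityʳ (x t)
      -- For disjoint blocks, flipping `B` and setting `l` commute, and `calm` says that setting `l`
      -- keeps the value at x^B.
      ...   | inj₂ l∩B = sensitive B∈ (begin
        f (flipB x B)                ≡⟨ xor≡false calm ⟨
        f (setBits s (flipB x B) l)  ≡⟨ f-ext _ _ commute ⟨
        f (flipB x′ B)               ≡⟨ eq ⟩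
        f x′                         ≡⟨ fx′≡fx ⟩
        f x                          ∎)
        where
        open ≡-Reasoning
        commute : ∀ t → flipB x′ B t ≡ setBits s (flipB x B) l t
        commute t with l t | Disjoint-off l B l∩B t
        ... | true  | off = trans (cong (s xor_) (off refl)) (Bool.xor-identityʳ s)
        ... | false | _   = refl

  -- Each `advance` spends g ≥ 1 alternations and at most 2 g c blocks. With no alternation left it
  -- is impossible, so then no block remains.
  block-bound : ∀ fuel {lo x hi k Bs} → k ≤ fuel → Config true lo x hi k Bs → length Bs ≤ 2 * (k * c)
  block-bound fuel {Bs = []} k≤ cfg = z≤n
  block-bound fuel {lo} {x} {hi} {k} {Bs@(B ∷ Bs₀)} k≤ cfg with good-direction x B Bs₀
  ... | l , s , l∈ , le = case s le
    where
    conclude : ∀ fuel g {lo′ x′ hi′ Bs′} → k ≤ fuel → 1 ≤ g → g ≤ k → Config true lo′ x′ hi′ (k ∸ g) Bs′ →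
               length Bs ≤ 2 * (g * c) + length Bs′ → length Bs ≤ 2 * (k * c)
    conclude zero       g k≤ 1≤g g≤k cfg′ bound = ⊥-elim (ℕ.<⇒≱ 1≤g (ℕ.≤-trans g≤k k≤))
    conclude (suc fuel) g {Bs′ = Bs′} k≤ 1≤g g≤k cfg′ bound = begin
      length Bs                              ≤⟨ bound ⟩
      2 * (g * c) + length Bs′               ≤⟨ ℕ.+-monoʳ-≤ (2 * (g * c)) (block-bound fuel k∸g≤ cfg′) ⟩
      2 * (g * c) + 2 * ((k ∸ g) * c)        ≡⟨ ℕ.*-distribˡ-+ 2 (g * c) ((k ∸ g) * c) ⟨
      2 * (g * c + (k ∸ g) * c)              ≡⟨ cong (2 *_) (ℕ.*-distribʳ-+ c g (k ∸ g)) ⟨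
      2 * ((g + (k ∸ g)) * c)                ≡⟨ cong (λ q → 2 * (q * c)) (ℕ.m+[n∸m]≡n g≤k) ⟩
      2 * (k * c)                            ∎
      where
      open ℕ.≤-Reasoning
      k∸g≤ : k ∸ g ≤ fuel
      k∸g≤ = s≤s⁻¹ (begin
        suc (k ∸ g)    ≡⟨ ℕ.+-comm 1 (k ∸ g) ⟩
        (k ∸ g) + 1    ≤⟨ ℕ.+-monoʳ-≤ (k ∸ g) 1≤g ⟩
        (k ∸ g) + g    ≡⟨ ℕ.m∸n+n≡m g≤k ⟩
        k              ≤⟨ k≤ ⟩
        suc fuel       ∎)
    case : ∀ s → col x Bs s l ≤ row x Bs s l → length Bs ≤ 2 * (k * c)
    case true  le = let (g , _ , _ , _ , 1≤g , g≤k , cfg′ , bound) = advance cfg l l∈ le in conclude fuel g k≤ 1≤g g≤k cfg′ bound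
    case false le = let (g , _ , _ , _ , 1≤g , g≤k , cfg′ , bound) = advance (Config-flip cfg) l l∈ le
                    in conclude fuel g k≤ 1≤g g≤k (Config-flip cfg′) bound

  -- The initial state comes from two greedy climbs towards `x`, one from each end of the cube,
  -- after discarding the blocks that meet the coordinates changed on the way.
  sensitivity-bound : ∀ x k Bs → (∀ {m} → Chain true allFalse allTrue m → m ≤ k) → AllPairs Disjoint Bs →
                      (∀ {B} → B ∈ Bs → f (flipB x B) ≢ f x) → length Bs ≤ 2 * (k * c)
  sensitivity-bound x k Bs short disjoint sensitive
    with greedy true (dist allFalse x) allFalse x ℕ.≤-refl (λ i ())
       | greedy false (dist allTrue x) allTrue x ℕ.≤-refl (λ i ())
  ... | z , g , z⊑x , chain , d , const | z′ , g′ , z′⊑x , chain′ , d′ , const′ = begin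
    length Bs                                        ≡⟨ length-reject t₁ Bs ⟩
    count t₁ Bs + length Bs₁                         ≡⟨ cong (count t₁ Bs +_) (length-reject t₂ Bs₁) ⟩
    count t₁ Bs + (count t₂ Bs₁ + length Bs₂)        ≡⟨ ℕ.+-assoc (count t₁ Bs) (count t₂ Bs₁) (length Bs₂) ⟨
    (count t₁ Bs + count t₂ Bs₁) + length Bs₂        ≤⟨ ℕ.+-mono-≤ (ℕ.+-mono-≤ (ℕ.≤-trans count₁ d) (ℕ.≤-trans count₂ d′)) (block-bound (k ∸ (g + g′)) ℕ.≤-refl config) ⟩
    (g * c + g′ * c) + 2 * ((k ∸ (g + g′)) * c)      ≡⟨ cong (_+ 2 * ((k ∸ (g + g′)) * c)) (ℕ.*-distribʳ-+ c g g′) ⟨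
    -- The initial climbs cost only `c` per alternation; doubling matches the rate of `block-bound`.
    (g + g′) * c + 2 * ((k ∸ (g + g′)) * c)          ≤⟨ ℕ.+-monoˡ-≤ (2 * ((k ∸ (g + g′)) * c)) (ℕ.m≤m+n ((g + g′) * c) _) ⟩
    2 * ((g + g′) * c) + 2 * ((k ∸ (g + g′)) * c)    ≡⟨ ℕ.*-distribˡ-+ 2 ((g + g′) * c) ((k ∸ (g + g′)) * c) ⟨
    2 * ((g + g′) * c + (k ∸ (g + g′)) * c)          ≡⟨ cong (2 *_) (ℕ.*-distribʳ-+ c (g + g′) (k ∸ (g + g′))) ⟨
    2 * (((g + g′) + (k ∸ (g + g′))) * c)            ≡⟨ cong (λ q → 2 * (q * c)) (ℕ.m+[n∸m]≡n g+g′≤k) ⟩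
    2 * (k * c)                                      ∎
    where
    open ℕ.≤-Reasoning
    t₁ t₂ : Input n → Bool
    t₁ B = does (touches? (diff allFalse z) B)
    t₂ B = does (touches? (diff allTrue z′) B)
    Bs₁ Bs₂ : List (Input n)
    Bs₁ = reject t₁ Bs
    Bs₂ = reject t₂ Bs₁
    disjoint₁ : AllPairs Disjoint Bs₁
    disjoint₁ = AllPairs.filter⁺ (λ B → t₁ B Bool.≟ false) disjoint
    witness : ∀ T B → does (touches? T B) ≡ true → Touches T B
    witness T B eq with touches? T B
    ... | yes t = t
    refute : ∀ T B → does (touches? T B) ≡ false → ¬ Touches T B
    refute T B eq with touches? T B
    ... | no ¬t = ¬t
    count₁ : count t₁ Bs ≤ dist allFalse z
    count₁ = count-touching t₁ (diff allFalse z) Bs disjoint (λ {B} _ → witness (diff allFalse z) B)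
    count₂ : count t₂ Bs₁ ≤ dist allTrue z′
    count₂ = count-touching t₂ (diff allTrue z′) Bs₁ disjoint₁ (λ {B} _ → witness (diff allTrue z′) B)
    upper-chain : Chain true z′ allTrue g′
    upper-chain = Chain-reverse chain′
    x⊑z′ : x ⊑[ true ] z′
    x⊑z′ = ⊑-flip z′⊑x
    total : ∀ {m} → Chain true z z′ m → (g + g′) + m ≤ k
    total {m} ch = subst (_≤ k) (trans (cong (g +_) (ℕ.+-comm m g′)) (sym (ℕ.+-assoc g g′ m))) (short (chain ++ᶜ (ch ++ᶜ upper-chain)))
    g+g′≤k : g + g′ ≤ k
    g+g′≤k = let (m , ch) = Chain-exists (⊑-trans z⊑x x⊑z′) in ℕ.≤-trans (ℕ.m≤m+n (g + g′) m) (total ch)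
    config : Config true z x z′ (k ∸ (g + g′)) Bs₂
    config = record
      { lo⊑x      = z⊑x
      ; x⊑hi      = x⊑z′
      ; below     = λ v p q → trans (const v p q) (sym (const x z⊑x ⊑-refl))
      ; above     = λ v p q → trans (const′ v (⊑-flip q) (⊑-flip p)) (sym (const′ x z′⊑x ⊑-refl))
      ; short     = λ {m} ch → ℕ.m+n≤o⇒m≤o∸n m (subst (_≤ k) (ℕ.+-comm (g + g′) m) (total ch))
      ; disjoint  = AllPairs.filter⁺ (λ B → t₂ B Bool.≟ false) disjoint₁
      ; free      = free′
      ; sensitive = λ B∈ → sensitive (proj₁ (∈-filter⁻ (λ B → t₁ B Bool.≟ false) {xs = Bs} (proj₁ (∈-filter⁻ (λ B → t₂ B Bool.≟ false) {xs = Bs₁} B∈))))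
      }
      where
      free′ : ∀ {B} → B ∈ Bs₂ → ∀ t → B t ≡ true → z t ≡ false × z′ t ≡ true
      free′ {B} B∈ t Bt =
        let (B∈₁ , e₂) = ∈-filter⁻ (λ B → t₂ B Bool.≟ false) {xs = Bs₁} B∈
            (_ , e₁)   = ∈-filter⁻ (λ B → t₁ B Bool.≟ false) {xs = Bs} B∈₁
        in lower-off (refute (diff allFalse z) B e₁) , upper-on (refute (diff allTrue z′) B e₂)
        where
        lower-off : ¬ Touches (diff allFalse z) B → z t ≡ false
        lower-off ¬t with z t in zt
        ... | false = refl
        ... | true  = ⊥-elim (¬t (t , Bt , zt))
        upper-on : ¬ Touches (diff allTrue z′) B → z′ t ≡ true
        upper-on ¬t with z′ t in zt
        ... | true  = refl
        ... | false = ⊥-elim (¬t (t , Bt , cong not zt))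

-- Monotone paths

raise : ∀ {n} → Fin n → Input n → Input n
raise i x j = if does (j Fin.≟ i) then true else x j

raise-at : ∀ {n} (i : Fin n) x → raise i x i ≡ true
raise-at i x with i Fin.≟ i
... | yes _  = refl
... | no i≢i = ⊥-elim (i≢i refl)

raise-off : ∀ {n} (i : Fin n) x j → j ≢ i → raise i x j ≡ x j
raise-off i x j j≢i with j Fin.≟ i
... | yes j≡i = ⊥-elim (j≢i j≡i)
... | no _    = refl

raise-⊒ : ∀ {n} (i : Fin n) x → x ⊑[ true ] raise i x
raise-⊒ i x j xj with j Fin.≟ i
... | yes _ = refl
... | no _  = xj

-- The end point of a MonoPath is an intensional function, so a pointwise equality cannot be realised by the empty path.
monoPath : ∀ {n} fuel (x y : Input n) → dist x y ≤ fuel → x ⊑[ true ] y →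
           (∀ i → x i ≡ y i) ⊎ Σ (List (Input n)) (MonoPath x y)
monoPath fuel x y le x⊑y with Fin.any? (λ i → (x i Bool.≟ false) ×-dec (y i Bool.≟ true))
... | no none = inj₁ same
  where
  same : ∀ i → x i ≡ y i
  same i with x i in xi | y i in yi
  ... | true  | true  = refl
  ... | false | false = refl
  ... | true  | false = trans (sym (x⊑y i xi)) yi
  ... | false | true  = ⊥-elim (none (i , xi , yi))
... | yes (i , xi , yi) = inj₂ (extend fuel le)
  where
  x′ : Input _
  x′ = raise i x
  x′⊑y : x′ ⊑[ true ] y
  x′⊑y j x′j with j Fin.≟ i
  ... | yes refl = yi
  ... | no _     = x⊑y j x′j
  x≢x′ : ¬ (∀ j → x j ≡ x′ j)
  x≢x′ eq = true≢false (trans (sym (raise-at i x)) (trans (sym (eq i)) xi))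
  closer : suc (dist x′ y) ≤ dist x y
  closer = ℕ.≤-trans (ℕ.+-monoˡ-≤ (dist x′ y) (dist-pos x≢x′)) (ℕ.≤-reflexive (sym (dist-+ true (raise-⊒ i x) x′⊑y)))
  extend : ∀ fuel → dist x y ≤ fuel → Σ (List (Input _)) (MonoPath x y)
  extend zero       le = ⊥-elim (ℕ.<⇒≱ (ℕ.≤-trans (s≤s z≤n) closer) le)
  extend (suc fuel) le with monoPath fuel x′ y (s≤s⁻¹ (ℕ.≤-trans closer le)) x′⊑y
  -- When the raised input agrees pointwise with `y`, the last step goes to `y` itself, the endpoint
  -- required by the path.
  ... | inj₁ x′≡y       = y ∷ [] , step (i , xi , yi , λ j j≢i → trans (sym (x′≡y j)) (raise-off i x j j≢i)) done
  ... | inj₂ (ys , path) = x′ ∷ ys , step (i , xi , raise-at i x , raise-off i x) path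

_++ᵖ_ : ∀ {n} {x y z : Input n} {ys zs} → MonoPath x y ys → MonoPath y z zs → MonoPath x z (ys ++ zs)
done     ++ᵖ q = q
step e p ++ᵖ q = step e (p ++ᵖ q)

alts-++ : ∀ {n} (f : BoolFun n) {x y ys} zs → MonoPath x y ys → alts f x (ys ++ zs) ≡ alts f x ys + alts f y zs
alts-++ f zs done = refl
alts-++ f {x} zs (step {y = y} {ys = ys} e p) = trans (cong (bit (f x xor f y) +_) (alts-++ f zs p))
  (sym (ℕ.+-assoc (bit (f x xor f y)) (alts f y ys) _))

alts-change : ∀ {n} (f : BoolFun n) {x y ys} → MonoPath x y ys → f x ≢ f y → 1 ≤ alts f x ys
alts-change f done neq = ⊥-elim (neq refl)
alts-change f {x} (step {y = y} e p) neq with f x xor f y in eq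
... | true  = s≤s z≤n
... | false = alts-change f p (neq ∘ trans (xor≡false eq))

module _ {n : ℕ} (f : BoolFun n) (f-ext : Extensional f) where

  open Alternation f f-ext

  -- Monotone paths joined through the turning points alternate at least once per turn. The left
  -- alternative covers pointwise equal end points, where the chain has no turns.
  chain⇒path : ∀ {x y m} → Chain true x y m →
               ((∀ i → x i ≡ y i) × m ≡ 0) ⊎ Σ (List (Input n)) λ ys → MonoPath x y ys × m ≤ alts f x ys
  chain⇒path {x} {y} (flat x⊑y _) with monoPath (dist x y) x y ℕ.≤-refl x⊑y
  ... | inj₁ x≡y        = inj₁ (x≡y , refl)
  ... | inj₂ (ys , path) = inj₂ (ys , path , z≤n)
  chain⇒path {x} {y} (turn {w} x⊑w fx≢fw c) with chain⇒path c
  -- Here `w` is `y` only pointwise, so the path is built directly from `x` to `y`.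
  ... | inj₁ (w≡y , refl) = short (monoPath (dist x y) x y ℕ.≤-refl (⊑-trans x⊑w (⊑-reflexive w≡y)))
    where
    fx≢fy : f x ≢ f y
    fx≢fy eq = fx≢fw (trans eq (sym (f-ext w y w≡y)))
    short : (∀ i → x i ≡ y i) ⊎ Σ (List (Input n)) (MonoPath x y) →
            ((∀ i → x i ≡ y i) × 1 ≡ 0) ⊎ Σ (List (Input n)) λ ys → MonoPath x y ys × 1 ≤ alts f x ys
    short (inj₁ x≡y)         = ⊥-elim (fx≢fy (f-ext x y x≡y))
    short (inj₂ (ys , path)) = inj₂ (ys , path , alts-change f path fx≢fy)
  ... | inj₂ (zs , rest , le) with monoPath (dist x w) x w ℕ.≤-refl x⊑w
  ...   | inj₁ x≡w         = ⊥-elim (fx≢fw (f-ext x w x≡w))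
  ...   | inj₂ (ys , path) = inj₂ (ys ++ zs , path ++ᵖ rest ,
          ℕ.≤-trans (ℕ.+-mono-≤ (alts-change f path fx≢fw) le) (ℕ.≤-reflexive (sym (alts-++ f zs path))))

  chain≤alt : ∀ {k m} → IsAlt f k → Chain true allFalse allTrue m → m ≤ k
  chain≤alt (_ , maximal) c with chain⇒path c
  ... | inj₁ (_ , refl)        = z≤n
  ... | inj₂ (ys , path , le) = ℕ.≤-trans le (maximal ys path)

-- From polynomial representations to the block sensitivity bound.

1≰⅓ : ¬ (1ℚ ℚ.≤ ⅓)
1≰⅓ le = ℚ.<-irrefl refl (ℚ.<-≤-trans (toWitness {a? = ⅓ ℚ.<? 1ℚ} tt) le)

-- Polynomial values depend only on the bits, and the thresholds 1/3 and 1 separate the two values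
-- of f.
NDRep⇒Extensional : ∀ {n} (f : BoolFun n) c → NDRep f c → Extensional f
NDRep⇒Extensional f c rep x x′ eq with f x in fx | f x′ in fx′
... | true  | true  = refl
... | false | false = refl
... | true  | false = ⊥-elim (1≰⅓ (ℚ.≤-trans (proj₂ (rep x) fx)
                        (subst (λ v → ℚ.∣ v ∣ ℚ.≤ ⅓) (sym (eval-ext c x x′ eq)) (proj₁ (rep x′) fx′))))
... | false | true  = ⊥-elim (1≰⅓ (ℚ.≤-trans (proj₂ (rep x′) fx′)
                        (subst (λ v → ℚ.∣ v ∣ ℚ.≤ ⅓) (eval-ext c x x′ eq) (proj₁ (rep x) fx))))

corner-gap : ∀ {n} (f : BoolFun n) c d → DegLe c d → NDRep f c → ∀ z y → f z ≡ false → f y ≡ true →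
             (∀ u → InCube y (diff z y) u → ¬ (∀ i → u i ≡ y i) → f u ≡ f z) → dist z y ≤ 105 * (d * d)
corner-gap f c d deg rep z y fz fy const =
  corner-degree y (diff z y) c d deg (λ u u∈ u≢y → proj₁ (rep u) (trans (const u u∈ u≢y) fz)) (proj₂ (rep y) fy)

constants : ∀ k D → 2 * (k * (105 * D)) ≡ 210 * k * D
constants = solve-∀

theorem2 : Σ ℕ λ C → ∀ (n : ℕ) (f : BoolFun n) (k b d d' : ℕ) → IsAlt f k → IsBS f b → IsN f d → IsN (compl f) d' → b ≤ C * k * ((d * d) ⊔ (d' * d'))
-- The factor 2 of `sensitivity-bound` times the 105 of `corner-degree`.
theorem2 = 210 , bound
  where
  bound : ∀ n (f : BoolFun n) (k b d d' : ℕ) → IsAlt f k → IsBS f b → IsN f d → IsN (compl f) d' → b ≤ 210 * k * ((d * d) ⊔ (d' * d'))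
  bound n f k b d d' alt ((x , B , disjoint , sensitive) , _) ((p , p-deg , p-rep) , _) ((q , q-deg , q-rep) , _) = begin
    b                       ≡⟨ length-tabulate B ⟨
    length (tabulate B)     ≤⟨ Blocks.sensitivity-bound f f-ext (105 * D) gap x k (tabulate B) (chain≤alt f f-ext alt)
                                 (AllPairs.tabulate⁺ (λ {i} {j} → disjoint i j))
                                 (λ B∈ → let (i , eq) = ∈-tabulate⁻ B∈ in subst (λ A → f (flipB x A) ≢ f x) (sym eq) (sensitive i)) ⟩
    2 * (k * (105 * D))     ≡⟨ constants k D ⟩
    210 * k * D             ∎
    where
    open ℕ.≤-Reasoning
    D : ℕ
    D = (d * d) ⊔ (d' * d')
    f-ext : Extensional f
    f-ext = NDRep⇒Extensional f p p-rep
    compl-cong : ∀ {u b} → f u ≡ b → compl f u ≡ (if b then false else true)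
    compl-cong eq = cong (λ b → if b then false else true) eq
    gap : ∀ z y → f z ≢ f y → (∀ u → InCube y (diff z y) u → ¬ (∀ i → u i ≡ y i) → f u ≡ f z) → dist z y ≤ 105 * D
    -- The value at the corner `y` selects the polynomial: the one for f if it is true, the one for
    -- `compl f` if it is false. This is where the maximum of the two squares enters.
    gap z y fz≢fy const with f z in fz | f y in fy
    ... | true  | true  = ⊥-elim (fz≢fy refl)
    ... | false | false = ⊥-elim (fz≢fy refl)
    ... | false | true  = ℕ.≤-trans
      (corner-gap f p d p-deg p-rep z y fz fy (λ u u∈ u≢y → trans (const u u∈ u≢y) (sym fz)))
      (ℕ.*-monoʳ-≤ 105 (ℕ.m≤m⊔n (d * d) (d' * d')))
    ... | true  | false = ℕ.≤-trans
      (corner-gap (compl f) q d' q-deg q-rep z y (compl-cong fz) (compl-cong fy)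
        (λ u u∈ u≢y → trans (compl-cong (const u u∈ u≢y)) (sym (compl-cong fz))))
      (ℕ.*-monoʳ-≤ 105 (ℕ.m≤n⊔m (d * d) (d' * d')))
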